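{- Let $q\geq 4$, let $\Gamma=H(q,q)$, let $C=C(A_q)\cup\mathrm{Rep}(q,q)$, and let $X=\mathrm{Diag}_q(S_q)\rtimes L\leq\mathrm{Aut}(\Gamma)$. Then $(C,X)$ is an elusive pair and $X$ is not transitive on $\Gamma_1(C)$. Moreover, for $q\geq 5$, $X$ is the setwise stabiliser in $\mathrm{Aut}(\Gamma)$ of $\Gamma_1(C)$.
   Context: Let $Q=\{1,\ldots,q\}$. $\Gamma=H(m,q)$ is the Hamming graph whose vertices are all $m$-tuples with entries in $Q$, two being adjacent if and only if they differ in exactly one position; the distance $d(\alpha,\beta)$ is the number of entries in which $\alpha,\beta$ differ. A code is a set $C$ of vertices; its minimum distance is $\delta=\min\{d(\alpha,\beta)\mid\alpha,\beta\in C,\alpha\neq\beta\}$; $\Gamma_1(C)$ is the set of vertices not in $C$ that are adjacent to at least one element of $C$. Elusive pair: if $C$ is a code in $\Gamma=H(m,q)$ with minimum distance $\delta$ and $X\leq\mathrm{Aut}(\Gamma)$ fixes $\Gamma_1(C)$ setwise but does not fix $C$ setwise, then $(C,X)$ is an elusive pair with parameters $(m,q,\delta)$. $\mathrm{Aut}(\Gamma)=N\rtimes L$ with $N\cong S_q^m$ and $L\cong S_m$, acting (on the right) by $\alpha^{g}=(\alpha_1^{g_1},\ldots,\alpha_m^{g_m})$ for $g=(g_1,\ldots,g_m)\in N$ and $\alpha^{\sigma}=(\alpha_{1^{\sigma^{ -1}}},\ldots,\alpha_{m^{\sigma^{ -1}}})$ for $\sigma\in L$. Here $m=q$. $\mathrm{Diag}_q(S_q)=\{(y,\ldots,y)\mid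 y\in S_q\}\leq N$. $S_q$ and $A_q$ are the symmetric and alternating groups on $Q$. For $g\in S_q$, $\alpha(g)=(1^g,\ldots,q^g)\in H(q,q)$, and for $T\subseteq S_q$, $C(T)=\{\alpha(g)\mid g\in T\}$. The repetition code is $\mathrm{Rep}(q,q)=\{(a,\ldots,a)\mid a\in Q\}\subseteq H(q,q)$. -}

module Defs where

open import Algebra.Bundles using (Group)
open import Data.Fin using (Fin)
open import Data.Fin.Permutation as Perm
  using (Permutation′; _⟨$⟩ʳ_; _⟨$⟩ˡ_; inverseˡ; inverseʳ)
open import Data.Fin.Permutation.Transposition.List using (TranspositionList; eval)
open import Data.Fin.Properties using (_≟_)
open import Data.List using (length)
open import Data.List.Relation.Unary.All using (All)
open import Data.Nat using (ℕ; _≤_)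
open import Data.Nat.Divisibility using (_∣_)
open import Data.Product using (_×_; _,_; ∃; ∃₂; ∃!; uncurry)
open import Data.Vec using (Vec; count; lookup; replicate; tabulate; zip)
open import Data.Vec.Properties using (lookup∘tabulate; tabulate∘lookup; tabulate-cong)
open import Function using (_∘_; _⇔_; mk⇔; _↔_; mk↔ₛ′; Inverse)
import Function.Construct.Composition as Comp
import Function.Construct.Identity as Id
import Function.Construct.Symmetry as Symm
open import Level using (0ℓ; _⊔_)
open import Relation.Binary using (Rel)
open import Relation.Binary.PropositionalEquality
open import Relation.Nullary using (¬_; ¬?)
open import Relation.Unary using (Pred; _∈_; _∉_; _≐_)

Vertex : ℕ → ℕ → Set
Vertex m q = Vec (Fin q) m

module _ {m q : ℕ} where

  Adjacent : Rel (Vertex m q) 0ℓ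
  Adjacent α β = ∃! _≡_ λ i → lookup α i ≢ lookup β i

  dist : Vertex m q → Vertex m q → ℕ
  dist α β = count (¬? ∘ uncurry _≟_) (zip α β)

Code : ℕ → ℕ → Set₁
Code m q = Pred (Vertex m q) 0ℓ

module _ {m q : ℕ} where

  record IsMinimumDistance (C : Code m q) (δ : ℕ) : Set where
    field
      attained : ∃₂ λ α β → α ∈ C × β ∈ C × α ≢ β × dist α β ≡ δ
      minimal  : ∀ {α β} → α ∈ C → β ∈ C → α ≢ β → δ ≤ dist α β

  Γ₁ : Code m q → Code m q
  Γ₁ C α = α ∉ C × ∃ λ β → β ∈ C × Adjacent α β

-- Automorphisms act on the right: in the group Aut below, the product
-- g ∙ h applies g first.

record Automorphism (m q : ℕ) : Set where
  field
    bijection : Vertex m q ↔ Vertex m q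
    adjacency : ∀ α β → Adjacent α β ⇔
                        Adjacent (Inverse.to bijection α) (Inverse.to bijection β)

open Automorphism

module _ {m q : ℕ} where

  infixl 8 _^_

  _^_ : Vertex m q → Automorphism m q → Vertex m q
  α ^ g = Inverse.to (bijection g) α

  private
    identity : Automorphism m q
    identity = record
      { bijection = Id.↔-id _
      ; adjacency = λ α β → Id.⇔-id _
      }

    compose : Automorphism m q → Automorphism m q → Automorphism m q
    compose g h = record
      { bijection = Comp.inverse (bijection g) (bijection h)
      ; adjacency = λ α β → Comp.equivalence (adjacency g α β) (adjacency h (α ^ g) (β ^ g))
      }

    invert : Automorphism m q → Automorphism m q
    invert g = record
      { bijection = Symm.↔-sym (bijection g)
      ; adjacency = λ α β → Symm.⇔-sym
          (subst₂ (λ α′ β′ → Adjacent (from α) (from β) ⇔ Adjacent α′ β′)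
                  (strictlyInverseˡ α) (strictlyInverseˡ β)
                  (adjacency g (from α) (from β)))
      }
      where open Inverse (bijection g)

    invert-cong : ∀ g h → (∀ α → α ^ g ≡ α ^ h) → ∀ α → α ^ invert g ≡ α ^ invert h
    invert-cong g h g≈h α = begin
      G.from α                     ≡⟨ cong G.from (H.strictlyInverseˡ α) ⟨
      G.from (H.to (H.from α))     ≡⟨ cong G.from (g≈h (H.from α)) ⟨
      G.from (G.to (H.from α))     ≡⟨ G.strictlyInverseʳ (H.from α) ⟩
      H.from α                     ∎
      where
      module G = Inverse (bijection g)
      module H = Inverse (bijection h)
      open ≡-Reasoning

  Aut : Group 0ℓ 0ℓ
  Aut = record
    { Carrier = Automorphism m q
    ; _≈_     = λ g h → ∀ α → α ^ g ≡ α ^ h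
    ; _∙_     = compose
    ; ε       = identity
    ; _⁻¹     = invert
    ; isGroup = record
      { isMonoid = record
        { isSemigroup = record
          { isMagma = record
            { isEquivalence = record
              { refl  = λ α → refl
              ; sym   = λ p α → sym (p α)
              ; trans = λ p r α → trans (p α) (r α)
              }
            ; ∙-cong = λ {g} {g′} {h} {h′} p r α → trans (cong (_^ h) (p α)) (r (α ^ g′))
            }
          ; assoc = λ g h k α → refl
          }
        ; identity = (λ g α → refl) , (λ g α → refl)
        }
      ; inverse = (λ g → Inverse.strictlyInverseˡ (bijection g))
                , (λ g → Inverse.strictlyInverseʳ (bijection g))
      ; ⁻¹-cong = λ {g} {h} → invert-cong g h
      }
    }

record IsSubgroup {c ℓ p} (G : Group c ℓ) (H : Pred (Group.Carrier G) p) : Set (c ⊔ ℓ ⊔ p) where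
  open Group G
  field
    resp-≈    : ∀ {g h} → g ≈ h → g ∈ H → h ∈ H
    ε-closed  : ε ∈ H
    ∙-closed  : ∀ {g h} → g ∈ H → h ∈ H → g ∙ h ∈ H
    ⁻¹-closed : ∀ {g} → g ∈ H → g ⁻¹ ∈ H

module _ {m q : ℕ} where

  image : Code m q → Automorphism m q → Code m q
  image S g β = ∃ λ α → α ∈ S × β ≡ α ^ g

  Stabiliser : Code m q → Pred (Automorphism m q) 0ℓ
  Stabiliser S g = image S g ≐ S

  Fixes : Pred (Automorphism m q) 0ℓ → Code m q → Set
  Fixes X S = ∀ {g} → g ∈ X → image S g ≐ S

  TransitiveOn : Pred (Automorphism m q) 0ℓ → Code m q → Set
  TransitiveOn X S = ∀ {α β} → α ∈ S → β ∈ S → ∃ λ g → g ∈ X × α ^ g ≡ β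

record IsElusivePairWith (m q δ : ℕ) (C : Code m q) (X : Pred (Automorphism m q) 0ℓ) : Set where
  field
    minimumDistance : IsMinimumDistance C δ
    subgroup        : IsSubgroup Aut X
    fixes-Γ₁        : Fixes X (Γ₁ C)
    ¬fixes-C        : ¬ Fixes X C

IsElusivePair : ∀ {m q} → Code m q → Pred (Automorphism m q) 0ℓ → Set
IsElusivePair {m} {q} C X = ∃ λ δ → IsElusivePairWith m q δ C X

module _ {m q : ℕ} where

  private
    vec-≡ : {α β : Vertex m q} → (∀ i → lookup α i ≡ lookup β i) → α ≡ β
    vec-≡ {α} {β} p =
      trans (sym (tabulate∘lookup α)) (trans (tabulate-cong p) (tabulate∘lookup β))

  actN : (Fin m → Permutation′ q) → Vertex m q → Vertex m q
  actN g α = tabulate λ i → g i ⟨$⟩ʳ lookup α i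

  actL : Permutation′ m → Vertex m q → Vertex m q
  actL σ α = tabulate λ i → lookup α (σ ⟨$⟩ˡ i)

  private
    lookup-actN : ∀ g α i → lookup (actN g α) i ≡ g i ⟨$⟩ʳ lookup α i
    lookup-actN g α = lookup∘tabulate _

    lookup-actL : ∀ σ α i → lookup (actL σ α) i ≡ lookup α (σ ⟨$⟩ˡ i)
    lookup-actL σ α = lookup∘tabulate _

    actN-inverse : ∀ g h → (∀ i a → h i ⟨$⟩ʳ (g i ⟨$⟩ʳ a) ≡ a) →
                   ∀ α → actN h (actN g α) ≡ α
    actN-inverse g h hg α = vec-≡ λ i →
      trans (lookup-actN h (actN g α) i) (trans (cong (h i ⟨$⟩ʳ_) (lookup-actN g α i)) (hg i _))

    actL-inverse : ∀ σ τ → (∀ i → σ ⟨$⟩ˡ (τ ⟨$⟩ˡ i) ≡ i) →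
                   ∀ α → actL τ (actL σ α) ≡ α
    actL-inverse σ τ στ α = vec-≡ λ i →
      trans (lookup-actL τ (actL σ α) i) (trans (lookup-actL σ α (τ ⟨$⟩ˡ i)) (cong (lookup α) (στ i)))

    actN-adjacent : ∀ g α β → Adjacent α β → Adjacent (actN g α) (actN g β)
    actN-adjacent g α β (i , αi≢βi , unique) =
      i
      , (λ eq → αi≢βi (begin
          lookup α i                          ≡⟨ inverseˡ (g i) ⟨
          g i ⟨$⟩ˡ (g i ⟨$⟩ʳ lookup α i)      ≡⟨ cong (g i ⟨$⟩ˡ_) (lookup-actN g α i) ⟨
          g i ⟨$⟩ˡ lookup (actN g α) i        ≡⟨ cong (g i ⟨$⟩ˡ_) eq ⟩
          g i ⟨$⟩ˡ lookup (actN g β) i        ≡⟨ cong (g i ⟨$⟩ˡ_) (lookup-actN g β i) ⟩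
          g i ⟨$⟩ˡ (g i ⟨$⟩ʳ lookup β i)      ≡⟨ inverseˡ (g i) ⟩
          lookup β i                          ∎))
      , λ {j} ≢j → unique λ eq → ≢j
          (trans (lookup-actN g α j) (trans (cong (g j ⟨$⟩ʳ_) eq) (sym (lookup-actN g β j))))
      where open ≡-Reasoning

    actL-adjacent : ∀ σ α β → Adjacent α β → Adjacent (actL σ α) (actL σ β)
    actL-adjacent σ α β (i , αi≢βi , unique) =
      σ ⟨$⟩ʳ i
      , (λ eq → αi≢βi (trans (sym (at α)) (trans eq (at β))))
      , λ {j} ≢j → trans
          (cong (σ ⟨$⟩ʳ_) (unique λ eq → ≢j
            (trans (lookup-actL σ α j) (trans eq (sym (lookup-actL σ β j))))))
          (inverseʳ σ)
      where
      at : ∀ γ → lookup (actL σ γ) (σ ⟨$⟩ʳ i) ≡ lookup γ i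
      at γ = trans (lookup-actL σ γ _) (cong (lookup γ) (inverseˡ σ))

  fromN : (Fin m → Permutation′ q) → Automorphism m q
  fromN g = record
    { bijection = mk↔ₛ′ (actN g) (actN g⁻¹)
                        (actN-inverse g⁻¹ g λ i a → inverseʳ (g i))
                        retract
    ; adjacency = λ α β → mk⇔ (actN-adjacent g α β)
        (subst₂ Adjacent (retract α) (retract β) ∘
         actN-adjacent g⁻¹ (actN g α) (actN g β))
    }
    where
    g⁻¹ : Fin m → Permutation′ q
    g⁻¹ i = Perm.flip (g i)
    retract = actN-inverse g g⁻¹ λ i a → inverseˡ (g i)

  fromL : Permutation′ m → Automorphism m q
  fromL σ = record
    { bijection = mk↔ₛ′ (actL σ) (actL σ⁻¹)
                        (actL-inverse σ⁻¹ σ λ i → inverseʳ σ)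
                        retract
    ; adjacency = λ α β → mk⇔ (actL-adjacent σ α β)
        (subst₂ Adjacent (retract α) (retract β) ∘
         actL-adjacent σ⁻¹ (actL σ α) (actL σ β))
    }
    where
    σ⁻¹ = Perm.flip σ
    retract = actL-inverse σ σ⁻¹ λ i → inverseˡ σ

  open Group (Aut {m} {q}) using (_≈_; _∙_)

  Diag : Pred (Automorphism m q) 0ℓ
  Diag g = ∃ λ (y : Permutation′ q) → g ≈ fromN (λ _ → y)

  L : Pred (Automorphism m q) 0ℓ
  L g = ∃ λ (σ : Permutation′ m) → g ≈ fromL σ

  -- Elements of Diag commute with elements of L, and Diag and L
  -- intersect trivially (L fixes every constant tuple), so the product
  -- set is the internal semidirect product of Diag and L.
  Diag⋊L : Pred (Automorphism m q) 0ℓ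
  Diag⋊L g = ∃₂ λ d l → d ∈ Diag × l ∈ L × g ≈ d ∙ l

module _ {q : ℕ} where

  -- eval reads a list of pairs (i , j) as a product of transpositions;
  -- the pairs must be off-diagonal since transpose i i is the identity.
  Alternating : Pred (Permutation′ q) 0ℓ
  Alternating g = ∃ λ (ts : TranspositionList q) →
    All (uncurry _≢_) ts × 2 ∣ length ts × eval ts Perm.≈ g

  permVertex : Permutation′ q → Vertex q q
  permVertex g = tabulate (g ⟨$⟩ʳ_)

  permCode : Pred (Permutation′ q) 0ℓ → Code q q
  permCode T α = ∃ λ g → g ∈ T × α ≡ permVertex g

Rep : ∀ m q → Code m q
Rep m q α = ∃ λ (a : Fin q) → α ≡ replicate m a

{-# OPTIONS --safe #-}
-- Γ₁(C) consists of the vertices with exactly one repeated value, taken twice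
-- (such a vertex lies next to two permutation vertices differing by a
-- transposition, so next to exactly one even one), and of the vertices that
-- are constant up to one coordinate. Both classes are invariant under
-- Diag ⋊ L, and they are disjoint; an odd element of the diagonal moves C.
-- Conversely, for q ≥ 5 the vertices all of whose neighbours lie in Γ₁(C) are
-- those of C(S_q) ∪ Rep(q,q), so the stabiliser of Γ₁(C) permutes them. A
-- permutation vertex has another one of these at distance 2 and a constant
-- vertex does not, so the stabiliser preserves Rep(q,q). An automorphism of a
-- Hamming graph permutes the coordinates and acts on each one separately,
-- and preserving the constant vertices makes these actions equal.

module Submission where

open import Defs
open import Algebra.Bundles using (Group)
open import Data.Fin using (Fin; zero; suc; punchOut)
open import Data.Fin.Patterns using (0F; 1F; 2F)
import Data.Fin.Permutation as Perm
open Perm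
  using (Permutation′; permutation; transpose; _∘ₚ_; _⟨$⟩ʳ_; _⟨$⟩ˡ_; inverseˡ; inverseʳ)
import Data.Fin.Permutation.Components as PC
open import Data.Fin.Permutation.Transposition.List using (TranspositionList; eval; decompose; eval-decompose)
open import Data.Fin.Properties
  using (_≟_; any?; all?; ¬∀⟶∃¬; punchOut-injective; pigeonhole; <⇒notInjective; <⇒≢)
open import Data.Bool using (true; false)
open import Data.Empty using (⊥; ⊥-elim)
open import Data.List using (List; []; _∷_; length)
import Data.List as List
import Data.List.Membership.Propositional as List∈
open import Data.List.Membership.DecPropositional using (_∉?_; _∈?_)
open import Data.List.Relation.Unary.All using (All; []; _∷_)
open import Data.List.Relation.Unary.Any using (here; there; index)
open import Data.List.Relation.Unary.Any.Properties using (lookup-index)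
open import Data.Nat using (ℕ; _≤_; _<_; zero; suc; z≤n; s≤s; parity)
open import Data.Nat.Divisibility using (_∣_; divides; _∣0; ∣-refl; ∣m∣n⇒∣m+n)
open import Data.Nat.Properties using (≤-refl; ≤-reflexive; ≤-trans; m≤m+n)
open import Data.Parity using (Parity; 0ℙ; 1ℙ; _+_; _*_; _⁻¹)
open import Data.Parity.Properties
  using (+-0-commutativeMonoid; +-comm; +-assoc; +-cancelʳ-≡; p+p≡0ℙ; *-zeroʳ; *-homo-*; +-homo-+)
open import Data.Product using (_×_; _,_; ∃; ∃₂; proj₁; proj₂; uncurry)
open import Data.Sum using (_⊎_; inj₁; inj₂; [_,_]′; map)
open import Data.Vec using (Vec; []; _∷_; lookup; replicate; tabulate; _[_]≔_)
open import Data.Vec.Properties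
  using (lookup∘tabulate; tabulate∘lookup; tabulate-cong; lookup-replicate;
         lookup∘update; lookup∘update′; []≔-lookup; ≡-dec)
open import Function using (_∘_; id; Injective; Inverse; Equivalence)
open import Level using (0ℓ)
open import Relation.Binary.PropositionalEquality
open import Relation.Nullary using (¬_; Dec; yes; no; does; contradiction; ¬?)
open import Relation.Nullary.Decidable using (dec-true; dec-false; decidable-stable; _→-dec_; _×-dec_)
open import Relation.Unary using (Pred; _∈_; _∉_; _∪_; _≐_)
open import Algebra.Properties.CommutativeMonoid.Sum +-0-commutativeMonoid
  using (sum; sum-syntax; ∑-distrib-+; sum-cong-≗; sum-permute; sum-replicate-zero)

-- Finite sets

-- Punching a missed value `j` out of the codomain would leave an injection into a smaller set.
injective⇒surjective : ∀ {n} {f : Fin n → Fin n} → Injective _≡_ _≡_ f → ∀ j → ∃ λ i → f i ≡ j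
injective⇒surjective {suc n} {f} f-inj j with any? (λ i → f i ≟ j)
... | yes p = p
... | no ¬p = contradiction
  (λ {i} {k} eq → f-inj (punchOut-injective (avoids i) (avoids k) eq))
  (<⇒notInjective {f = λ i → punchOut (avoids i)} ≤-refl)
  where
  avoids : ∀ i → j ≢ f i
  avoids i eq = ¬p (i , sym eq)

injective⇒permutation : ∀ {n} {f : Fin n → Fin n} → Injective _≡_ _≡_ f →
                        ∃ λ (π : Permutation′ n) → ∀ i → π ⟨$⟩ʳ i ≡ f i
injective⇒permutation {f = f} f-inj =
  permutation f (proj₁ ∘ f-surj) (proj₂ ∘ f-surj) (λ i → f-inj (proj₂ (f-surj (f i)))) , λ _ → refl
  where f-surj = injective⇒surjective f-inj

permutation-injective : ∀ {n} (π : Permutation′ n) → Injective _≡_ _≡_ (π ⟨$⟩ʳ_)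
permutation-injective π eq = trans (sym (inverseˡ π)) (trans (cong (π ⟨$⟩ˡ_) eq) (inverseˡ π))

-- Pigeonhole: if every `k` occurred in `xs`, two of them would share an index and so be equal.
fresh : ∀ {n} (xs : List (Fin n)) → length xs < n → ∃ λ k → k List∈.∉ xs
fresh {n} xs short with any? (λ k → _∉?_ _≟_ k xs)
... | yes p = p
... | no ¬p = contradiction collision λ (i , j , i<j , eq) → <⇒≢ i<j
  (trans (lookup-index (mem i)) (trans (cong (List.lookup xs) eq) (sym (lookup-index (mem j)))))
  where
  mem : ∀ k → k List∈.∈ xs
  mem k = decidable-stable (_∈?_ _≟_ k xs) λ k∉xs → ¬p (k , k∉xs)
  collision = pigeonhole short (index ∘ mem)

-- Parity of permutations

-- The indicator of `i < j` in the field with two elements: conjunction becomes a product, and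
-- counting modulo 2 a sum.
precedes : ∀ {n} → Fin n → Fin n → Parity
precedes zero    zero    = 0ℙ
precedes zero    (suc j) = 1ℙ
precedes (suc i) zero    = 0ℙ
precedes (suc i) (suc j) = precedes i j

precedes-irrefl : ∀ {n} (i : Fin n) → precedes i i ≡ 0ℙ
precedes-irrefl zero    = refl
precedes-irrefl (suc i) = precedes-irrefl i

precedes-opposite : ∀ {n} {i j : Fin n} → i ≢ j → precedes j i ≡ precedes i j ⁻¹
precedes-opposite {i = zero}  {zero}  i≢j = contradiction refl i≢j
precedes-opposite {i = zero}  {suc j} i≢j = refl
precedes-opposite {i = suc i} {zero}  i≢j = refl
precedes-opposite {i = suc i} {suc j} i≢j = precedes-opposite (i≢j ∘ cong suc)

inversion : ∀ {n} → Permutation′ n → Fin n → Fin n → Parity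
inversion π i j = precedes i j * precedes (π ⟨$⟩ʳ j) (π ⟨$⟩ʳ i)

-- The number of inversions modulo 2. Each unordered pair counts once, because `precedes i j`
-- selects one of its two orders.
sgn : ∀ {n} → Permutation′ n → Parity
sgn {n} π = ∑[ i < n ] ∑[ j < n ] inversion π i j

sgn-cong : ∀ {n} {π ρ : Permutation′ n} → π Perm.≈ ρ → sgn π ≡ sgn ρ
sgn-cong {n} {π} {ρ} eq = sum-cong-≗ {n} λ i → sum-cong-≗ {n} λ j →
  cong (precedes i j *_) (cong₂ precedes (eq j) (eq i))

-- Off the diagonal the terms cancel in pairs modulo 2; the induction strips the first row together
-- with the equal first column.
hollow-symmetric-sum : ∀ {n} (e : Fin n → Fin n → Parity) →
                       (∀ i j → e i j ≡ e j i) → (∀ i → e i i ≡ 0ℙ) →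
                       ∑[ i < n ] ∑[ j < n ] e i j ≡ 0ℙ
hollow-symmetric-sum {zero}  e e-sym e-hollow = refl
hollow-symmetric-sum {suc n} e e-sym e-hollow = begin
  (e 0F 0F + row) + ∑[ i < n ] (e (suc i) 0F + rest i)  ≡⟨ cong₂ _+_ (cong (_+ row) (e-hollow 0F)) (∑-distrib-+ _ rest) ⟩
  row + (∑[ i < n ] e (suc i) 0F + sum rest)            ≡⟨ cong (λ s → row + (s + sum rest)) (sum-cong-≗ λ i → e-sym (suc i) 0F) ⟩
  row + (row + sum rest)                                ≡⟨ +-assoc row row (sum rest) ⟨
  (row + row) + sum rest                                ≡⟨ cong₂ _+_ (p+p≡0ℙ row)
    (hollow-symmetric-sum _ (λ i j → e-sym (suc i) (suc j)) (e-hollow ∘ suc)) ⟩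
  0ℙ                                                    ∎
  where
  open ≡-Reasoning
  row = ∑[ j < n ] e 0F (suc j)
  rest : Fin n → Parity
  rest i = ∑[ j < n ] e (suc i) (suc j)

∑∑-distrib-+ : ∀ {n} (e f : Fin n → Fin n → Parity) →
               ∑[ i < n ] ∑[ j < n ] (e i j + f i j) ≡
               ∑[ i < n ] ∑[ j < n ] e i j + ∑[ i < n ] ∑[ j < n ] f i j
∑∑-distrib-+ e f = trans
  (sum-cong-≗ λ i → ∑-distrib-+ (e i) (f i))
  (∑-distrib-+ (λ i → sum (e i)) (λ i → sum (f i)))

-- Modulo 2, the inversions of π, of τ (reindexed by π) and of their product
-- add up to a symmetric function of the two positions.
sgn-homo : ∀ {n} (π τ : Permutation′ n) → sgn (π ∘ₚ τ) ≡ sgn π + sgn τ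
sgn-homo {n} π τ = cancel (begin
  sgn (π ∘ₚ τ) + (sgn π + sgn τ)
    ≡⟨ cong (λ s → sgn (π ∘ₚ τ) + (sgn π + s)) reindex ⟩
  sgn (π ∘ₚ τ) + (sgn π + ∑[ i < n ] ∑[ j < n ] shifted i j)
    ≡⟨ cong (sgn (π ∘ₚ τ) +_) (∑∑-distrib-+ (inversion π) shifted) ⟨
  sgn (π ∘ₚ τ) + ∑[ i < n ] ∑[ j < n ] (inversion π i j + shifted i j)
    ≡⟨ ∑∑-distrib-+ (inversion (π ∘ₚ τ)) (λ i j → inversion π i j + shifted i j) ⟨
  ∑[ i < n ] ∑[ j < n ] total i j
    ≡⟨ hollow-symmetric-sum total total-sym total-hollow ⟩
  0ℙ  ∎)
  where
  open ≡-Reasoning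

  shifted total : Fin n → Fin n → Parity
  shifted i j = inversion τ (π ⟨$⟩ʳ i) (π ⟨$⟩ʳ j)
  total i j = inversion (π ∘ₚ τ) i j + (inversion π i j + shifted i j)

  reindex : sgn τ ≡ ∑[ i < n ] ∑[ j < n ] shifted i j
  reindex = trans (sum-permute (λ x → sum (inversion τ x)) π)
                  (sum-cong-≗ λ i → sum-permute (inversion τ (π ⟨$⟩ʳ i)) π)

  cancel : ∀ {p q} → p + q ≡ 0ℙ → p ≡ q
  cancel {0ℙ} {0ℙ} _ = refl
  cancel {1ℙ} {1ℙ} _ = refl

  -- The variables say whether `i` precedes `j` at the start, after `π`, and after both `π` and `τ`.
  -- Exchanging `i` and `j` complements all three.
  polynomial-sym : ∀ a b c → (a * c ⁻¹) + ((a * b ⁻¹) + (b * c ⁻¹)) ≡ (a ⁻¹ * c) + ((a ⁻¹ * b) + (b ⁻¹ * c))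
  polynomial-sym 0ℙ 0ℙ 0ℙ = refl
  polynomial-sym 0ℙ 0ℙ 1ℙ = refl
  polynomial-sym 0ℙ 1ℙ 0ℙ = refl
  polynomial-sym 0ℙ 1ℙ 1ℙ = refl
  polynomial-sym 1ℙ 0ℙ 0ℙ = refl
  polynomial-sym 1ℙ 0ℙ 1ℙ = refl
  polynomial-sym 1ℙ 1ℙ 0ℙ = refl
  polynomial-sym 1ℙ 1ℙ 1ℙ = refl

  total-sym : ∀ i j → total i j ≡ total j i
  total-sym i j with i ≟ j
  ... | yes refl = refl
  ... | no i≢j
    rewrite precedes-opposite i≢j
          | precedes-opposite (i≢j ∘ permutation-injective π)
          | precedes-opposite (i≢j ∘ permutation-injective π ∘ permutation-injective τ)
    = polynomial-sym (precedes i j) _ _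

  total-hollow : ∀ i → total i i ≡ 0ℙ
  total-hollow i
    rewrite precedes-irrefl i | precedes-irrefl (π ⟨$⟩ʳ i) = refl

-- Transpositions and their sign

transpose-matchˡ : ∀ {n} (i j : Fin n) → PC.transpose i j i ≡ j
transpose-matchˡ i j rewrite dec-true (i ≟ i) refl = refl

transpose-matchʳ : ∀ {n} (i j : Fin n) → PC.transpose i j j ≡ i
transpose-matchʳ i j with j ≟ i
... | yes j≡i = j≡i
... | no  _ rewrite dec-true (j ≟ j) refl = refl

transpose-mismatch : ∀ {n} {i j k : Fin n} → k ≢ i → k ≢ j → PC.transpose i j k ≡ k
transpose-mismatch {i = i} {j} {k} k≢i k≢j
  rewrite dec-false (k ≟ i) k≢i | dec-false (k ≟ j) k≢j = refl

transpose-conjugate : ∀ {n} (π : Permutation′ n) i j →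
  transpose i j ∘ₚ π Perm.≈ π ∘ₚ transpose (π ⟨$⟩ʳ i) (π ⟨$⟩ʳ j)
transpose-conjugate π i j k = conjugate (k ≟ i) (k ≟ j)
  where
  conjugate : Dec (k ≡ i) → Dec (k ≡ j) →
              π ⟨$⟩ʳ PC.transpose i j k ≡ PC.transpose (π ⟨$⟩ʳ i) (π ⟨$⟩ʳ j) (π ⟨$⟩ʳ k)
  conjugate (yes refl) _ =
    trans (cong (π ⟨$⟩ʳ_) (transpose-matchˡ i j)) (sym (transpose-matchˡ (π ⟨$⟩ʳ i) _))
  conjugate (no _) (yes refl) =
    trans (cong (π ⟨$⟩ʳ_) (transpose-matchʳ i j)) (sym (transpose-matchʳ (π ⟨$⟩ʳ i) (π ⟨$⟩ʳ j)))
  conjugate (no k≢i) (no k≢j) =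
    trans (cong (π ⟨$⟩ʳ_) (transpose-mismatch k≢i k≢j))
          (sym (transpose-mismatch (k≢i ∘ permutation-injective π) (k≢j ∘ permutation-injective π)))

-- Only the first two points are inverted. The later rows consist of products
-- `precedes i j * precedes j i`, which vanish because no two points precede each other both ways.
sgn-transpose-01 : ∀ {n} → sgn (transpose {suc (suc n)} 0F 1F) ≡ 1ℙ
sgn-transpose-01 {n} = cong₂ (λ s t → (1ℙ + s) + t) (sum-replicate-zero n)
  (cong₂ _+_ (sum-replicate-zero n) (trans (sum-cong-≗ tail-row) (sum-replicate-zero n)))
  where
  ordered : ∀ {n} (i j : Fin n) → precedes i j * precedes j i ≡ 0ℙ
  ordered zero    zero    = refl
  ordered zero    (suc j) = refl
  ordered (suc i) zero    = refl
  ordered (suc i) (suc j) = ordered i j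

  tail-row : ∀ i → ∑[ j < n ] (precedes i j * precedes j i) ≡ 0ℙ
  tail-row i = trans (sum-cong-≗ (ordered i)) (sum-replicate-zero n)

-- First 0 is carried to `i`, then the image of 1 to `j`. The second transposition leaves `i` alone,
-- since `i` is neither `j` nor the image of 1.
move-01 : ∀ {n} {i j : Fin (suc (suc n))} → i ≢ j →
          ∃ λ (π : Permutation′ (suc (suc n))) → π ⟨$⟩ʳ 0F ≡ i × π ⟨$⟩ʳ 1F ≡ j
move-01 {i = i} {j} i≢j =
  τ ∘ₚ transpose (τ ⟨$⟩ʳ 1F) j
  , trans (cong (PC.transpose (τ ⟨$⟩ʳ 1F) j) τ0≡i) (transpose-mismatch i≢τ1 i≢j)
  , transpose-matchˡ (τ ⟨$⟩ʳ 1F) j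
  where
  τ = transpose 0F i
  τ0≡i : τ ⟨$⟩ʳ 0F ≡ i
  τ0≡i = transpose-matchˡ 0F i
  i≢τ1 : i ≢ τ ⟨$⟩ʳ 1F
  i≢τ1 eq with () ← permutation-injective τ {0F} {1F} (trans τ0≡i eq)

-- Every transposition is conjugate to that of 0 and 1, and a homomorphism into a commutative group
-- is constant on conjugates.
sgn-transpose : ∀ {n} {i j : Fin n} → i ≢ j → sgn (transpose i j) ≡ 1ℙ
sgn-transpose {suc zero} {0F} {0F} i≢j = contradiction refl i≢j
sgn-transpose {suc (suc n)} {i} {j} i≢j with move-01 i≢j
... | π , refl , refl = +-cancelʳ-≡ (sgn π) _ _ (begin
  sgn (transpose i j) + sgn π        ≡⟨ +-comm (sgn (transpose i j)) (sgn π) ⟩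
  sgn π + sgn (transpose i j)        ≡⟨ sgn-homo π (transpose i j) ⟨
  sgn (π ∘ₚ transpose i j)           ≡⟨ sgn-cong {π = transpose 0F 1F ∘ₚ π} {π ∘ₚ transpose i j} (transpose-conjugate π 0F 1F) ⟨
  sgn (transpose 0F 1F ∘ₚ π)         ≡⟨ sgn-homo (transpose 0F 1F) π ⟩
  sgn (transpose {suc (suc n)} 0F 1F) + sgn π  ≡⟨ cong (_+ sgn π) (sgn-transpose-01 {n}) ⟩
  1ℙ + sgn π                         ∎)
  where open ≡-Reasoning

sgn-id : ∀ {n} → sgn (Perm.id {n}) ≡ 0ℙ
sgn-id {n} = +-cancelʳ-≡ (sgn (Perm.id {n})) _ _
  (sym (sgn-homo {n} Perm.id Perm.id))

sgn-eval : ∀ {n} {ts : TranspositionList n} → All (uncurry _≢_) ts → sgn (eval ts) ≡ parity (length ts)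
sgn-eval {n} []                               = sgn-id {n}
sgn-eval {ts = (i , j) ∷ ts} (i≢j ∷ distinct) =
  trans (sgn-homo (transpose i j) (eval ts)) (trans
    (cong₂ _+_ (sgn-transpose i≢j) (sgn-eval distinct))
    (sym (+-homo-+ 1 (length ts))))

even-parity : ∀ {n} → 2 ∣ n → parity n ≡ 0ℙ
even-parity (divides k refl) = trans (*-homo-* k 2) (*-zeroʳ (parity k))

-- Even permutations

sgn-alternating : ∀ {n} {π : Permutation′ n} → Alternating π → sgn π ≡ 0ℙ
sgn-alternating {π = π} (ts , distinct , even , eq) =
  trans (sym (sgn-cong {π = eval ts} {π} eq)) (trans (sgn-eval distinct) (even-parity even))

-- The two sides have different signs. This excludes distance 2 inside `C(A_q)` and shows that an
-- odd diagonal element moves the code.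
alternating-≉-transpose : ∀ {n} {π ρ : Permutation′ n} {i j} → Alternating π → Alternating ρ → i ≢ j →
                          ¬ (π Perm.≈ transpose i j ∘ₚ ρ)
alternating-≉-transpose {π = π} {ρ} {i} {j} π-alt ρ-alt i≢j eq = 0ℙ≢1ℙ (begin
  0ℙ                              ≡⟨ sgn-alternating {π = π} π-alt ⟨
  sgn π                           ≡⟨ sgn-cong {π = π} {transpose i j ∘ₚ ρ} eq ⟩
  sgn (transpose i j ∘ₚ ρ)        ≡⟨ sgn-homo (transpose i j) ρ ⟩
  sgn (transpose i j) + sgn ρ     ≡⟨ cong₂ _+_ (sgn-transpose i≢j) (sgn-alternating {π = ρ} ρ-alt) ⟩
  1ℙ                              ∎)
  where
  open ≡-Reasoning
  0ℙ≢1ℙ : 0ℙ ≢ 1ℙ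
  0ℙ≢1ℙ ()

-- A decomposition may contain trivial pairs `(i , i)`, which would falsify the parity count in
-- `Alternating`.
drop-diagonal : ∀ {n} (ts : TranspositionList n) →
                ∃ λ us → All (uncurry _≢_) us × eval us Perm.≈ eval ts
drop-diagonal [] = [] , [] , λ _ → refl
drop-diagonal ((i , j) ∷ ts) with drop-diagonal ts | i ≟ j
... | us , distinct , eq | no  i≢j  = (i , j) ∷ us , i≢j ∷ distinct , λ k → eq (PC.transpose i j k)
... | us , distinct , eq | yes refl =
  us , distinct , λ k → trans (eq k) (cong (eval ts ⟨$⟩ʳ_) (sym (transpose-trivial k)))
  where
  transpose-trivial : ∀ k → PC.transpose i i k ≡ k
  transpose-trivial k with k ≟ i
  ... | yes refl = refl
  ... | no  k≢i  rewrite dec-false (k ≟ i) k≢i = refl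

even⊎odd : ∀ n → 2 ∣ n ⊎ 2 ∣ suc n
even⊎odd zero    = inj₁ (2 ∣0)
even⊎odd (suc n) with even⊎odd n
... | inj₁ even = inj₂ (∣m∣n⇒∣m+n ∣-refl even)
... | inj₂ odd  = inj₁ odd

-- Prefixing one transposition changes the parity of the length of a decomposition.
alternating⊎transpose : ∀ {n} (π : Permutation′ n) {i j} → i ≢ j →
                        Alternating π ⊎ Alternating (transpose i j ∘ₚ π)
alternating⊎transpose π {i} {j} i≢j with drop-diagonal (decompose π)
... | ts , distinct , eq with even⊎odd (length ts)
...   | inj₁ even = inj₁ (ts , distinct , even , π≈)
  where
  π≈ : eval ts Perm.≈ π
  π≈ k = trans (eq k) (eval-decompose π k)
...   | inj₂ odd  = inj₂ ((i , j) ∷ ts , i≢j ∷ distinct , odd , λ k → π≈ (PC.transpose i j k))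
  where
  π≈ : eval ts Perm.≈ π
  π≈ k = trans (eq k) (eval-decompose π k)

-- Automorphisms of Hamming graphs

lookup-ext : ∀ {m} {A : Set} {α β : Vec A m} → (∀ i → lookup α i ≡ lookup β i) → α ≡ β
lookup-ext {α = α} {β} eq = trans (sym (tabulate∘lookup α)) (trans (tabulate-cong eq) (tabulate∘lookup β))

-- Connectedness of the Hamming graph as an induction principle: the entries of `α` are overwritten
-- one by one with those of `β`, including entries that already agree.
walk : ∀ {m} {A : Set} (P : Vec A m → Set) (β : Vec A m) →
       (∀ γ j → P γ → P (γ [ j ]≔ lookup β j)) → ∀ {α} → P α → P β
walk P []      step {[]}    p = p
walk P (b ∷ β) step {a ∷ α} p = walk (P ∘ (b ∷_)) β (λ γ j → step (b ∷ γ) (suc j)) (step (a ∷ α) zero p)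

-- Edges and their directions

module _ {m q : ℕ} where

  infix 4 _~[_]_

  -- Adjacency with the differing coordinate, the direction of the edge, exposed in the type, so
  -- that directions can be compared.
  record _~[_]_ (α : Vertex m q) (i : Fin m) (β : Vertex m q) : Set where
    constructor _,_
    field
      differ : lookup α i ≢ lookup β i
      agree  : ∀ {j} → j ≢ i → lookup α j ≡ lookup β j

  open _~[_]_

  private
    variable
      α β γ δ : Vertex m q
      i j k l : Fin m

  ~⇒adjacent : α ~[ i ] β → Adjacent α β
  ~⇒adjacent {i = i} (αi≢βi , agree) =
    i , αi≢βi , λ {j} αj≢βj → decidable-stable (i ≟ j) λ i≢j → αj≢βj (agree (i≢j ∘ sym))

  adjacent⇒~ : ∀ α β → Adjacent α β → ∃ λ i → α ~[ i ] β
  adjacent⇒~ α β (i , αi≢βi , unique) =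
    i , αi≢βi , λ {j} j≢i → decidable-stable (lookup α j ≟ lookup β j) (j≢i ∘ sym ∘ unique)

  ~-position : α ~[ i ] β → lookup α j ≢ lookup β j → j ≡ i
  ~-position {i = i} {j = j} (_ , agree) αj≢βj = decidable-stable (j ≟ i) (αj≢βj ∘ agree)

  ~-sym : α ~[ i ] β → β ~[ i ] α
  ~-sym (αi≢βi , agree) = αi≢βi ∘ sym , sym ∘ agree

  ~-update : ∀ {a} → lookup α i ≢ a → α ~[ i ] (α [ i ]≔ a)
  ~-update {α} {i} αi≢a =
    αi≢a ∘ (λ eq → trans eq (lookup∘update i α _)) , λ j≢i → sym (lookup∘update′ j≢i α _)

  -- All three vertices agree off `i`, so distinct ones must differ at `i`.
  ~-line : α ~[ i ] β → α ~[ i ] γ → β ≢ γ → β ~[ i ] γ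
  ~-line {α} {i} {β} {γ} (_ , α-β) (_ , α-γ) β≢γ = βi≢γi , β-γ
    where
    β-γ : ∀ {j} → j ≢ i → lookup β j ≡ lookup γ j
    β-γ j≢i = trans (sym (α-β j≢i)) (α-γ j≢i)
    same : lookup β i ≡ lookup γ i → ∀ j → lookup β j ≡ lookup γ j
    same eq j with j ≟ i
    ... | yes refl = eq
    ... | no  j≢i  = β-γ j≢i
    βi≢γi : lookup β i ≢ lookup γ i
    βi≢γi eq = β≢γ (lookup-ext (same eq))

  -- Otherwise `β` and `γ` would differ both at `i` and at `k`.
  ~-triangle : α ~[ i ] β → β ~[ j ] γ → α ~[ k ] γ → k ≡ i
  ~-triangle {α} {i} {β} {j} {γ} {k} (αi≢βi , α-β) β~γ (αk≢γk , α-γ) = decidable-stable (k ≟ i) λ k≢i →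
    let i≡j = ~-position β~γ λ βi≡γi → αi≢βi (trans (α-γ (k≢i ∘ sym)) (sym βi≡γi))
        k≡j = ~-position β~γ λ βk≡γk → αk≢γk (trans (α-β k≢i) βk≡γk)
    in k≢i (trans k≡j (sym i≡j))

  -- Opposite edges of a square are parallel: the difference between `α` and `δ` at `j` survives the
  -- steps to `β` and `γ`, neither of which changes entry `j`.
  ~-square : α ~[ i ] β → α ~[ j ] δ → β ~[ k ] γ → δ ~[ l ] γ → i ≢ j → j ≢ l → j ≡ k
  ~-square (_ , α-β) (αj≢δj , _) β~γ (_ , δ-γ) i≢j j≢l =
    ~-position β~γ λ βj≡γj → αj≢δj (trans (α-β (i≢j ∘ sym)) (trans βj≡γj (sym (δ-γ j≢l))))

  module _ (g : Automorphism m q) where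

    ^-injective : α ^ g ≡ β ^ g → α ≡ β
    ^-injective {α} {β} eq = trans (sym (strictlyInverseʳ α)) (trans (cong from eq) (strictlyInverseʳ β))
      where open Inverse (Automorphism.bijection g)

    ^-~ : α ~[ i ] β → ∃ λ j → (α ^ g) ~[ j ] (β ^ g)
    ^-~ {α} {i} {β} = adjacent⇒~ (α ^ g) (β ^ g) ∘ Equivalence.to (Automorphism.adjacency g α β) ∘ ~⇒adjacent

    ^-two-apart : lookup α i ≢ lookup β i → lookup α j ≢ lookup β j → i ≢ j → ¬ ((α ^ g) ~[ k ] (β ^ g))
    ^-two-apart {α} {i} {β} {j} {k} αi≢βi αj≢βj i≢j αg~βg
      with _ , α~β ← adjacent⇒~ α β (Equivalence.from (Automorphism.adjacency g α β) (~⇒adjacent αg~βg))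
      = i≢j (trans (~-position α~β αi≢βi) (sym (~-position α~β αj≢βj)))

    ^-≢ : lookup α i ≢ lookup β i → α ^ g ≢ β ^ g
    ^-≢ {α} {i} {β} αi≢βi eq = αi≢βi (cong (λ γ → lookup γ i) (^-injective eq))

    -- The vertices `β` and `γ` are two apart, whereas images in a common direction would lie on a
    -- line and be adjacent.
    ^-directions-differ : α ~[ i ] β → α ~[ j ] γ → i ≢ j →
                          (α ^ g) ~[ k ] (β ^ g) → (α ^ g) ~[ l ] (γ ^ g) → k ≢ l
    ^-directions-differ {α} {i} {β} {j} {γ} {k} (αi≢βi , α-β) (αj≢γj , α-γ) i≢j αg~βg αg~γg refl =
      ^-two-apart βi≢γi βj≢γj i≢j
        (~-line αg~βg αg~γg (^-≢ βi≢γi))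
      where
      βi≢γi : lookup β i ≢ lookup γ i
      βi≢γi eq = αi≢βi (trans (α-γ i≢j) (sym eq))
      βj≢γj : lookup β j ≢ lookup γ j
      βj≢γj eq = αj≢γj (trans (α-β (i≢j ∘ sym)) eq)

    MapsDirections : (Fin m → Fin m) → Vertex m q → Set
    MapsDirections π α = ∀ {i β} → α ~[ i ] β → (α ^ g) ~[ π i ] (β ^ g)

    -- One reference neighbour is chosen in each direction. Any other neighbour in that direction
    -- forms a triangle with it and `α`, and the image of a triangle has a single direction.
    directions-at : 1 < q → ∀ α → ∃ λ π → MapsDirections π α
    directions-at 1<q α = (λ i → proj₁ (image-edge i)) , maps
      where
      other : ∀ i → ∃ λ a → lookup α i ≢ a
      other i with a , a∉ ← fresh (lookup α i ∷ []) 1<q = a , λ eq → a∉ (here (sym eq))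
      neighbour : Fin m → Vertex m q
      neighbour i = α [ i ]≔ proj₁ (other i)
      edge : ∀ i → α ~[ i ] neighbour i
      edge i = ~-update {α} {i} (proj₂ (other i))
      image-edge : ∀ i → ∃ λ j → (α ^ g) ~[ j ] (neighbour i ^ g)
      image-edge i = ^-~ (edge i)
      maps : MapsDirections (λ i → proj₁ (image-edge i)) α
      maps {i} {β} α~β with ≡-dec _≟_ (neighbour i) β
      ... | yes refl = proj₂ (image-edge i)
      ... | no  ν≢β
        with _ , νg~βg ← ^-~ (~-line (edge i) α~β ν≢β)
           | k , αg~βg ← ^-~ α~β
        with refl ← ~-triangle (proj₂ (image-edge i)) νg~βg αg~βg
        = αg~βg

    -- An edge at `β` parallel to `α ~[ j ] β` lies on the same line through `α`. Any other edge is
    -- completed to a square, whose image has parallel opposite edges.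
    directions-propagate : ∀ {π} → MapsDirections π α → α ~[ j ] β → MapsDirections π β
    directions-propagate {α} {j} {β} {π} maps α~β {i} {γ} β~γ with i ≟ j
    ... | yes refl with ≡-dec _≟_ α γ
    ...   | yes refl = ~-sym (maps α~β)
    ...   | no  α≢γ  = ~-line (maps α~β) (maps α~γ) (^-≢ (differ β~γ))
      where
      α~γ : α ~[ i ] γ
      α~γ = ~-line (~-sym α~β) β~γ α≢γ
    directions-propagate {α} {j} {β} {π} maps α~β {i} {γ} β~γ | no i≢j =
      subst (λ k → (β ^ g) ~[ k ] (γ ^ g)) (sym πi≡k) (proj₂ βg~γg)
      where
      βg~γg = ^-~ β~γ
      -- The fourth corner of the square, reached from `α` by an edge parallel to that from `β` to
      -- `γ`.
      ε = α [ i ]≔ lookup γ i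
      α~ε : α ~[ i ] ε
      α~ε = ~-update {α} {i} λ eq → differ β~γ (trans (sym (agree α~β i≢j)) eq)
      ε~γ : ε ~[ j ] γ
      ε~γ = (λ eq → differ α~β (trans (sym (lookup∘update′ (i≢j ∘ sym) α _))
               (trans eq (sym (agree β~γ (i≢j ∘ sym))))))
          , ε-γ
        where
        ε-γ : ∀ {k} → k ≢ j → lookup ε k ≡ lookup γ k
        ε-γ {k} k≢j with k ≟ i
        ... | yes refl = lookup∘update i α _
        ... | no  k≢i  = trans (lookup∘update′ k≢i α _) (trans (agree α~β k≢j) (agree β~γ k≢i))
      εg~γg = ^-~ ε~γ
      πi≡k : π i ≡ proj₁ βg~γg
      πi≡k = ~-square
        (maps α~β) (maps α~ε) (proj₂ βg~γg) (proj₂ εg~γg)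
        (^-directions-differ α~β α~ε (i≢j ∘ sym) (maps α~β) (maps α~ε))
        (^-directions-differ (~-sym α~ε) ε~γ i≢j
          (~-sym (maps α~ε)) (proj₂ εg~γg))

    directions : 1 < q → Vertex m q → ∃ λ π → ∀ α → MapsDirections π α
    directions 1<q ω with π , maps ← directions-at 1<q ω = π , λ α → walk (MapsDirections π) α (step α) maps
      where
      step : ∀ {π} α γ j → MapsDirections π γ → MapsDirections π (γ [ j ]≔ lookup α j)
      step {π} α γ j p with lookup γ j ≟ lookup α j
      ... | yes eq = subst (MapsDirections π) (sym (trans (cong (γ [ j ]≔_) (sym eq)) ([]≔-lookup γ j))) p
      ... | no neq = directions-propagate p (~-update {γ} {j} neq)

    directions-injective : ∀ {π} → 1 < q → Vertex m q → (∀ α → MapsDirections π α) → Injective _≡_ _≡_ π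
    directions-injective {π} 1<q ω maps {i} {j} πi≡πj
      with a , a∉ ← fresh (lookup ω i ∷ []) 1<q | b , b∉ ← fresh (lookup ω j ∷ []) 1<q
      = decidable-stable (i ≟ j) λ i≢j →
        let ω~α = ~-update {ω} {i} {a} (differs a∉)
            ω~β = ~-update {ω} {j} {b} (differs b∉)
        in ^-directions-differ ω~α ω~β i≢j (maps ω ω~α) (maps ω ω~β) πi≡πj
      where
      differs : ∀ {i a} → a List∈.∉ lookup ω i ∷ [] → lookup ω i ≢ a
      differs a∉ eq = a∉ (here (sym eq))

    -- Along a walk from `α` to `β` entry `i` never changes, so each proper step has direction
    -- `j ≢ i`, and its image leaves entry `π i` unchanged.
    image-coordinate : ∀ {π} → Injective _≡_ _≡_ π → (∀ α → MapsDirections π α) →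
                       lookup α i ≡ lookup β i → lookup (α ^ g) (π i) ≡ lookup (β ^ g) (π i)
    image-coordinate {α} {i} {β} {π} π-injective maps eq = sym (proj₂ (walk P β step {α} (eq , refl)))
      where
      P : Vertex m q → Set
      P γ = lookup γ i ≡ lookup β i × lookup (γ ^ g) (π i) ≡ lookup (α ^ g) (π i)
      step : ∀ γ j → P γ → P (γ [ j ]≔ lookup β j)
      step γ j (γi≡βi , same) with lookup γ j ≟ lookup β j
      ... | yes γj≡βj = subst P (sym (trans (cong (γ [ j ]≔_) (sym γj≡βj)) ([]≔-lookup γ j))) (γi≡βi , same)
      ... | no  γj≢βj =
        trans (lookup∘update′ i≢j γ _) γi≡βi ,
        trans (sym (agree (maps γ (~-update {γ} {j} γj≢βj)) (i≢j ∘ π-injective))) same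
        where
        i≢j : i ≢ j
        i≢j refl = γj≢βj γi≡βi

    -- This says that `g` permutes the coordinates and acts on each of them separately.
    image-coordinates : 1 < q → Vertex m q → ∃ λ (π : Permutation′ m) →
      ∀ {α β i} → lookup α i ≡ lookup β i → lookup (α ^ g) (π ⟨$⟩ʳ i) ≡ lookup (β ^ g) (π ⟨$⟩ʳ i)
    image-coordinates 1<q ω
      with π , maps ← directions 1<q ω
      with π-injective ← directions-injective 1<q ω maps
      with ρ , ρ≗π ← injective⇒permutation {f = π} π-injective
      = ρ , λ {α} {β} {i} eq → subst (λ k → lookup (α ^ g) k ≡ lookup (β ^ g) k) (sym (ρ≗π i))
                                     (image-coordinate {α} {i} {β} π-injective maps eq)

-- The neighbours of the code

module _ {q : ℕ} where

  private
    variable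
      α β : Vertex q q
      i j k l : Fin q

  InjectiveOff : Fin q → Vertex q q → Set
  InjectiveOff i α = ∀ {k l} → k ≢ i → l ≢ i → lookup α k ≡ lookup α l → k ≡ l

  -- Exactly one value of α is repeated, and it is taken exactly twice.
  Paired : Vertex q q → Set
  Paired α = ∃₂ λ i j → i ≢ j × lookup α i ≡ lookup α j × InjectiveOff i α

  NearConstant : Vertex q q → Set
  NearConstant α = ∃₂ λ i a → lookup α i ≢ a × (∀ {k} → k ≢ i → lookup α k ≡ a)

  Boundary : Vertex q q → Set
  Boundary α = Paired α ⊎ NearConstant α

  Constant : Vertex q q → Set
  Constant α = ∃ λ a → ∀ k → lookup α k ≡ a

  -- The vertices of C(S_q) ∪ Rep(q,q).
  Core : Vertex q q → Set
  Core α = Injective _≡_ _≡_ (lookup α) ⊎ Constant α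

  two-others : 3 < q → ∀ i j → ∃₂ λ k l → k ≢ l × (k ≢ i × k ≢ j) × (l ≢ i × l ≢ j)
  two-others 3<q i j
    with k , k∉ ← fresh (i ∷ j ∷ []) (≤-trans (m≤m+n 3 1) 3<q)
    with l , l∉ ← fresh (i ∷ j ∷ k ∷ []) 3<q
    = k , l , l∉ ∘ there ∘ there ∘ here ∘ sym
    , (k∉ ∘ here , k∉ ∘ there ∘ here) , (l∉ ∘ here , l∉ ∘ there ∘ here)

  -- If every value occurred off `i`, a choice of preimages would be an injection of `Fin q` into
  -- itself, hence surjective, although it avoids `i`.
  missing-value : (α : Vertex q q) → ∀ i → ∃ λ a → ∀ {k} → k ≢ i → lookup α k ≢ a
  missing-value α i with any? (λ a → all? (λ k → ¬? (k ≟ i) →-dec ¬? (lookup α k ≟ a)))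
  ... | yes (a , p) = a , p _
  ... | no ¬p = contradiction (proj₂ (injective⇒surjective section-injective i)) (proj₁ (proj₂ (preimage _)))
    where
    preimage : ∀ a → ∃ λ k → k ≢ i × lookup α k ≡ a
    preimage a with any? (λ k → ¬? (k ≟ i) ×-dec (lookup α k ≟ a))
    ... | yes p  = p
    ... | no ¬p′ = contradiction (a , λ k k≢i eq → ¬p′ (k , k≢i , eq)) ¬p
    section-injective : Injective _≡_ _≡_ (proj₁ ∘ preimage)
    section-injective {a} {b} eq =
      trans (sym (proj₂ (proj₂ (preimage a)))) (trans (cong (lookup α) eq) (proj₂ (proj₂ (preimage b))))

  fill-injective : ∀ {a} → InjectiveOff i α → (∀ {k} → k ≢ i → lookup α k ≢ a) →
                   Injective _≡_ _≡_ (lookup (α [ i ]≔ a))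
  fill-injective {i} {α} {a} off missing {k} {l} eq with k ≟ i | l ≟ i
  ... | yes refl | yes refl = refl
  ... | yes refl | no  l≢i  =
    contradiction (trans (sym (lookup∘update′ l≢i α a)) (trans (sym eq) (lookup∘update i α a))) (missing l≢i)
  ... | no  k≢i  | yes refl =
    contradiction (trans (sym (lookup∘update′ k≢i α a)) (trans eq (lookup∘update i α a))) (missing k≢i)
  ... | no  k≢i  | no  l≢i  =
    off k≢i l≢i (trans (sym (lookup∘update′ k≢i α a)) (trans eq (lookup∘update′ l≢i α a)))

  -- Any collision involves `i`. If it is `l` that equals `i`, discarding `k` instead of `i` is just
  -- as good, since the two positions carry the same value.
  paired-collision : Paired α → k ≢ l → lookup α k ≡ lookup α l → InjectiveOff k α
  paired-collision {α} {k} {l} (i , _ , _ , _ , off) k≢l αk≡αl with k ≟ i | l ≟ i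
  ... | yes refl | _        = off
  ... | no  k≢i  | no  l≢i  = contradiction (off k≢i l≢i αk≡αl) k≢l
  ... | no  k≢i  | yes refl = off′
    where
    off′ : InjectiveOff k α
    off′ {x} {y} x≢k y≢k eq with x ≟ i | y ≟ i
    ... | yes refl | yes refl = refl
    ... | yes refl | no  y≢i  = contradiction (off y≢i k≢i (trans (sym eq) (sym αk≡αl))) y≢k
    ... | no  x≢i  | yes refl = contradiction (off x≢i k≢i (trans eq (sym αk≡αl))) x≢k
    ... | no  x≢i  | no  y≢i  = off x≢i y≢i eq

  -- The exceptional value occurs only once, so a repeated value is the majority value.
  nearConstant-collision : NearConstant α → k ≢ l → lookup α k ≡ lookup α l →
    ∃ λ p → ∀ {x} → x ≢ p → lookup α x ≡ lookup α k
  nearConstant-collision {α} {k} {l} (p , a , αp≢a , rest) k≢l αk≡αl with k ≟ p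
  ... | yes refl = contradiction (trans αk≡αl (rest (k≢l ∘ sym))) αp≢a
  ... | no  k≢p  = p , λ x≢p → trans (rest x≢p) (sym (rest k≢p))

  paired⇒¬nearConstant : 3 < q → Paired α → ¬ NearConstant α
  paired⇒¬nearConstant 3<q (i , _ , _ , _ , off) (p , a , _ , rest)
    with k , l , k≢l , (k≢i , k≢p) , (l≢i , l≢p) ← two-others 3<q i p
    = k≢l (off k≢i l≢i (trans (rest k≢p) (sym (rest l≢p))))

  core⇒¬boundary : 3 < q → Core α → ¬ Boundary α
  core⇒¬boundary 3<q (inj₁ inj) (inj₁ (_ , _ , i≢j , eq , _)) = i≢j (inj eq)
  core⇒¬boundary 3<q (inj₁ inj) (inj₂ (i , _ , _ , rest))
    with k , l , k≢l , (k≢i , _) , (l≢i , _) ← two-others 3<q i i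
    = k≢l (inj (trans (rest k≢i) (sym (rest l≢i))))
  core⇒¬boundary 3<q (inj₂ (_ , const)) (inj₁ (i , _ , _ , _ , off))
    with k , l , k≢l , (k≢i , _) , (l≢i , _) ← two-others 3<q i i
    = k≢l (off k≢i l≢i (trans (const k) (sym (const l))))
  core⇒¬boundary 3<q (inj₂ (_ , const)) (inj₂ (i , _ , αi≢a , rest))
    with k , _ , _ , (k≢i , _) , _ ← two-others 3<q i i
    = αi≢a (trans (const i) (trans (sym (const k)) (rest k≢i)))

  -- In a permutation vertex, the new value at `i` already occurs at exactly one other position `j`.
  core-neighbour : Core α → α ~[ i ] β → Boundary β
  core-neighbour {α} {i} {β} (inj₁ inj) (αi≢βi , α-β)
    with j , αj≡βi ← injective⇒surjective {f = lookup α} inj (lookup β i)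
    = let j≢i : j ≢ i
          j≢i j≡i = αi≢βi (trans (cong (lookup α) (sym j≡i)) αj≡βi)
      in inj₁ (i , j , j≢i ∘ sym , sym (trans (sym (α-β j≢i)) αj≡βi) ,
               λ k≢i l≢i eq → inj (trans (α-β k≢i) (trans eq (sym (α-β l≢i)))))
  core-neighbour {α} {i} {β} (inj₂ (a , const)) (αi≢βi , α-β) =
    inj₂ (i , a , (λ eq → αi≢βi (trans (const i) (sym eq))) , λ k≢i → trans (sym (α-β k≢i)) (const _))

  -- Recovers the core from the boundary through adjacency alone. If `α` has a collision at `i` and
  -- `j` but also a different value at `k`, copying the entry at `k` into `i` gives a neighbour `ν`;
  -- either type of boundary vertex for `ν` leads to a neighbour of `α` outside the boundary.
  full⇒core : 4 < q → (∀ {i β} → α ~[ i ] β → Boundary β) → Core α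
  full⇒core {α} 4<q full
    with any? (λ i → any? (λ j → ¬? (i ≟ j) ×-dec (lookup α i ≟ lookup α j)))
  ... | no ¬collision = inj₁ λ {i} {j} eq → decidable-stable (i ≟ j) λ i≢j → ¬collision (i , j , i≢j , eq)
  ... | yes (i , j , i≢j , αi≡αj) with all? (λ k → lookup α k ≟ lookup α i)
  ...   | yes const = inj₂ (lookup α i , const)
  ...   | no ¬const
    with k , αk≢αi ← ¬∀⟶∃¬ q (λ k → lookup α k ≡ lookup α i) (λ k → lookup α k ≟ lookup α i) ¬const
    = contradiction (full (~-update {α = α} {i} (αk≢αi ∘ sym))) [ not-paired , not-nearConstant ]′
    where
    3<q : 3 < q
    3<q = ≤-trans (m≤m+n 4 1) 4<q

    ν : Vertex q q
    ν = α [ i ]≔ lookup α k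

    νi≡αk : lookup ν i ≡ lookup α k
    νi≡αk = lookup∘update i α _

    i≢k : i ≢ k
    i≢k refl = αk≢αi refl

    νi≡νk : lookup ν i ≡ lookup ν k
    νi≡νk = trans νi≡αk (sym (lookup∘update′ (i≢k ∘ sym) α _))

    -- Here `α` is injective off `i`, so placing the missing value at `i` gives a permutation vertex
    -- next to `α`.
    not-paired : ¬ Paired ν
    not-paired paired with a , missing ← missing-value α i =
      core⇒¬boundary {α [ i ]≔ a} 3<q (inj₁ (fill-injective {i} {α} {a} off missing))
        (full (~-update {α = α} {i} {a} λ αi≡a → missing (i≢j ∘ sym) (trans (sym αi≡αj) αi≡a)))
      where
      off : InjectiveOff i α
      off x≢i y≢i eq = paired-collision {ν} paired i≢k νi≡νk x≢i y≢i
        (trans (lookup∘update′ x≢i α _) (trans eq (sym (lookup∘update′ y≢i α _))))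

    -- Now α takes the value α i at i and j only, and α k elsewhere; a third
    -- value at i gives a neighbour with three values, one of them repeated
    -- at least three times.
    not-nearConstant : ¬ NearConstant ν
    not-nearConstant nearConstant
      with p , νx≡νi ← nearConstant-collision {ν} nearConstant i≢k νi≡νk
      with d , d∉ ← fresh (lookup α i ∷ lookup α k ∷ []) (≤-trans (m≤m+n 3 2) 4<q)
      = two-valued p νx≡νi d d∉
      where
      two-valued : ∀ p → (∀ {x} → x ≢ p → lookup ν x ≡ lookup ν i) →
                   ∀ d → d List∈.∉ lookup α i ∷ lookup α k ∷ [] → ⊥
      two-valued p νx≡νi d d∉ =
        [ γ-not-paired , γ-not-nearConstant ]′ (full (~-update {α = α} {i} {d} (d∉ ∘ here ∘ sym)))
        where

        αj≢αk : lookup α j ≢ lookup α k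
        αj≢αk eq = αk≢αi (sym (trans αi≡αj eq))

        γ : Vertex q q
        γ = α [ i ]≔ d

        majority : ∀ {x} → x ≢ i → x ≢ j → lookup γ x ≡ lookup α k
        majority {x} x≢i x≢j = begin
          lookup γ x      ≡⟨ lookup∘update′ x≢i α d ⟩
          lookup α x      ≡⟨ lookup∘update′ x≢i α _ ⟨
          lookup ν x      ≡⟨ νx≡νi (λ x≡p → x≢j (trans x≡p (sym j≡p))) ⟩
          lookup ν i      ≡⟨ νi≡αk ⟩
          lookup α k      ∎
          where
          open ≡-Reasoning
          j≡p : j ≡ p
          j≡p = decidable-stable (j ≟ p) λ j≢p →
            αj≢αk (trans (sym (lookup∘update′ (i≢j ∘ sym) α _)) (trans (νx≡νi j≢p) νi≡αk))

        -- Two majority positions besides `p′`, `i` and `j` are needed, hence `q` at least 5.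
        γ-not-paired : ¬ Paired γ
        γ-not-paired (p′ , _ , _ , _ , off)
          with x , x∉ ← fresh (p′ ∷ i ∷ j ∷ []) 3<q
          with y , y∉ ← fresh (x ∷ p′ ∷ i ∷ j ∷ []) 4<q
          = y∉ (here (sym (off (x∉ ∘ here) (y∉ ∘ there ∘ here)
              (trans (majority (x∉ ∘ there ∘ here) (x∉ ∘ there ∘ there ∘ here))
                     (sym (majority (y∉ ∘ there ∘ there ∘ here) (y∉ ∘ there ∘ there ∘ there ∘ here)))))))

        -- The majority value is repeated at `x` and `y`, yet both `i` and `j` deviate from it, so
        -- each would be the single exception.
        γ-not-nearConstant : ¬ NearConstant γ
        γ-not-nearConstant nearConstant′
          with x , y , x≢y , (x≢i , x≢j) , (y≢i , y≢j) ← two-others 3<q i j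
          with p′ , rest ← nearConstant-collision {γ} nearConstant′ x≢y (trans (majority x≢i x≢j) (sym (majority y≢i y≢j)))
          = i≢j (trans (decidable-stable (i ≟ p′) λ i≢p′ →
                          d∉ (there (here (trans (sym (lookup∘update i α d)) (trans (rest i≢p′) (majority x≢i x≢j))))))
                       (sym (decidable-stable (j ≟ p′) λ j≢p′ →
                          αj≢αk (trans (sym (lookup∘update′ (i≢j ∘ sym) α d)) (trans (rest j≢p′) (majority x≢i x≢j))))))

-- The action of the group

module AutGroup {q : ℕ} = Group (Aut {q} {q})

ExtendedCode : ∀ q → Code q q
ExtendedCode q = permCode Alternating ∪ Rep q q

module _ {q : ℕ} where

  private
    variable
      α β : Vertex q q
      y z σ τ : Permutation′ q
      g h : Automorphism q q

  open AutGroup {q} using (_∙_; ε) renaming (_⁻¹ to invert)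

  ^-invert : ∀ (g : Automorphism q q) α → (α ^ g) ^ invert g ≡ α
  ^-invert g = AutGroup.inverseʳ g

  invert-^ : ∀ (g : Automorphism q q) α → (α ^ invert g) ^ g ≡ α
  invert-^ g = AutGroup.inverseˡ g

  -- The entrywise form of membership in `Diag⋊L`, in which products and inverses need no
  -- rearranging of diagonal and coordinate factors.
  Acts : Permutation′ q → Permutation′ q → Automorphism q q → Set
  Acts y σ g = ∀ α k → lookup (α ^ g) (σ ⟨$⟩ʳ k) ≡ y ⟨$⟩ʳ lookup α k

  fromN∙fromL-acts : ∀ y σ → Acts y σ (fromN (λ _ → y) ∙ fromL σ)
  fromN∙fromL-acts y σ α k = begin
    lookup (actL σ (actN (λ _ → y) α)) (σ ⟨$⟩ʳ k)       ≡⟨ lookup∘tabulate _ (σ ⟨$⟩ʳ k) ⟩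
    lookup (actN (λ _ → y) α) (σ ⟨$⟩ˡ (σ ⟨$⟩ʳ k))       ≡⟨ cong (lookup (actN (λ _ → y) α)) (inverseˡ σ) ⟩
    lookup (actN (λ _ → y) α) k                         ≡⟨ lookup∘tabulate _ k ⟩
    y ⟨$⟩ʳ lookup α k                                   ∎
    where open ≡-Reasoning

  Diag⋊L⇒acts : g ∈ Diag⋊L → ∃₂ λ y σ → Acts y σ g
  Diag⋊L⇒acts {g} (d , l , (y , d≈) , (σ , l≈) , g≈) = y , σ , λ α k →
    trans (cong (λ γ → lookup γ (σ ⟨$⟩ʳ k)) (trans (g≈ α) (trans (l≈ (α ^ d)) (cong (actL σ) (d≈ α)))))
          (fromN∙fromL-acts y σ α k)

  acts⇒Diag⋊L : Acts y σ g → g ∈ Diag⋊L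
  acts⇒Diag⋊L {y} {σ} {g} acts =
    fromN (λ _ → y) , fromL σ , (y , λ _ → refl) , (σ , λ _ → refl) , λ α → lookup-ext λ k →
      subst (λ k → lookup (α ^ g) k ≡ lookup (α ^ (fromN (λ _ → y) ∙ fromL σ)) k) (inverseʳ σ)
        (trans (acts α (σ ⟨$⟩ˡ k)) (sym (fromN∙fromL-acts y σ α (σ ⟨$⟩ˡ k))))

  acts-∙ : Acts y σ g → Acts z τ h → Acts (y ∘ₚ z) (σ ∘ₚ τ) (g ∙ h)
  acts-∙ {σ = σ} {g = g} {z = z} g-acts h-acts α k =
    trans (h-acts (α ^ g) (σ ⟨$⟩ʳ k)) (cong (z ⟨$⟩ʳ_) (g-acts α k))

  acts-invert : Acts y σ g → Acts (Perm.flip y) (Perm.flip σ) (invert g)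
  acts-invert {y} {σ} {g} acts α k = begin
    lookup γ (σ ⟨$⟩ˡ k)                          ≡⟨ inverseˡ y ⟨
    y ⟨$⟩ˡ (y ⟨$⟩ʳ lookup γ (σ ⟨$⟩ˡ k))          ≡⟨ cong (y ⟨$⟩ˡ_) (acts γ (σ ⟨$⟩ˡ k)) ⟨
    y ⟨$⟩ˡ lookup (γ ^ g) (σ ⟨$⟩ʳ (σ ⟨$⟩ˡ k))    ≡⟨ cong (y ⟨$⟩ˡ_) (cong₂ lookup (invert-^ g α) (inverseʳ σ)) ⟩
    y ⟨$⟩ˡ lookup α k                            ∎
    where
    open ≡-Reasoning
    γ : Vertex q q
    γ = α ^ invert g

  Diag⋊L-subgroup : IsSubgroup (Aut {q} {q}) Diag⋊L
  Diag⋊L-subgroup = record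
    { resp-≈    = λ g≈h (d , l , d∈ , l∈ , g≈dl) → d , l , d∈ , l∈ , λ α → trans (sym (g≈h α)) (g≈dl α)
    ; ε-closed  = acts⇒Diag⋊L {Perm.id} {Perm.id} {ε} λ _ _ → refl
    ; ∙-closed  = λ {g} {h} g∈ h∈ →
        let y , σ , g-acts = Diag⋊L⇒acts {g} g∈
            z , τ , h-acts = Diag⋊L⇒acts {h} h∈
        in acts⇒Diag⋊L {y ∘ₚ z} {σ ∘ₚ τ} {g ∙ h} (acts-∙ {y} {σ} {g} {z} {τ} {h} g-acts h-acts)
    ; ⁻¹-closed = λ {g} g∈ →
        let y , σ , g-acts = Diag⋊L⇒acts {g} g∈
        in acts⇒Diag⋊L {Perm.flip y} {Perm.flip σ} {invert g} (acts-invert {y} {σ} {g} g-acts)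
    }

  -- Invariance of the boundary and its identification with the neighbours of the code

  acts-nearConstant : Acts y σ g → NearConstant α → NearConstant (α ^ g)
  acts-nearConstant {y} {σ} {g} {α} acts (i , a , αi≢a , rest) =
    σ ⟨$⟩ʳ i , y ⟨$⟩ʳ a , (λ eq → αi≢a (permutation-injective y (trans (sym (acts α i)) eq))) , λ {k} k≢σi →
      trans (cong (lookup (α ^ g)) (sym (inverseʳ σ))) (trans (acts α (σ ⟨$⟩ˡ k))
        (cong (y ⟨$⟩ʳ_) (rest λ eq → k≢σi (trans (sym (inverseʳ σ)) (cong (σ ⟨$⟩ʳ_) eq)))))

  acts-paired : Acts y σ g → Paired α → Paired (α ^ g)
  acts-paired {y} {σ} {g} {α} acts (i , j , i≢j , αi≡αj , off) =
    σ ⟨$⟩ʳ i , σ ⟨$⟩ʳ j , i≢j ∘ permutation-injective σ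
    , trans (acts α i) (trans (cong (y ⟨$⟩ʳ_) αi≡αj) (sym (acts α j)))
    , λ k≢σi l≢σi eq → permutation-injective (Perm.flip σ) (off (pull k≢σi) (pull l≢σi)
        (permutation-injective y (trans (at _) (trans eq (sym (at _))))))
    where
    pull : ∀ {k} → k ≢ σ ⟨$⟩ʳ i → σ ⟨$⟩ˡ k ≢ i
    pull k≢σi eq = k≢σi (trans (sym (inverseʳ σ)) (cong (σ ⟨$⟩ʳ_) eq))
    at : ∀ k → y ⟨$⟩ʳ lookup α (σ ⟨$⟩ˡ k) ≡ lookup (α ^ g) k
    at k = trans (sym (acts α (σ ⟨$⟩ˡ k))) (cong (lookup (α ^ g)) (inverseʳ σ))

  Diag⋊L-boundary : g ∈ Diag⋊L → Boundary α → Boundary (α ^ g)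
  Diag⋊L-boundary {g} {α} g∈ with y , σ , acts ← Diag⋊L⇒acts {g} g∈ =
    map (acts-paired {y} {σ} {g} {α} acts) (acts-nearConstant {y} {σ} {g} {α} acts)

  lookup-permVertex : ∀ (π : Permutation′ q) k → lookup (permVertex π) k ≡ π ⟨$⟩ʳ k
  lookup-permVertex π = lookup∘tabulate (π ⟨$⟩ʳ_)

  injective⇒permVertex : Injective _≡_ _≡_ (lookup α) → ∃ λ π → α ≡ permVertex π
  injective⇒permVertex {α} inj with π , π≗α ← injective⇒permutation {f = lookup α} inj =
    π , lookup-ext λ k → trans (sym (π≗α k)) (sym (lookup-permVertex π k))

  code⇒core : α ∈ ExtendedCode q → Core α
  code⇒core (inj₁ (π , _ , refl)) = inj₁ λ {i} {j} eq →
    permutation-injective π (trans (sym (lookup-permVertex π i)) (trans eq (lookup-permVertex π j)))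
  code⇒core (inj₂ (a , refl)) = inj₂ (a , λ k → lookup-replicate k a)

  Γ₁⇒boundary : α ∈ Γ₁ (ExtendedCode q) → Boundary α
  Γ₁⇒boundary {α} (_ , β , β∈ , adj) with _ , α~β ← adjacent⇒~ α β adj =
    core-neighbour (code⇒core β∈) (~-sym α~β)

  -- Of the two permutation vertices next to a paired vertex, exactly one is
  -- even, since they differ by a transposition.
  boundary⇒Γ₁ : 3 < q → Boundary α → α ∈ Γ₁ (ExtendedCode q)
  boundary⇒Γ₁ {α} 3<q boundary = (λ α∈ → core⇒¬boundary {α = α} 3<q (code⇒core α∈) boundary) , codeword boundary
    where
    codeword : Boundary α → ∃ λ β → β ∈ ExtendedCode q × Adjacent α β
    codeword (inj₂ (i , a , αi≢a , rest)) =
      replicate q a , inj₂ (a , refl) , ~⇒adjacent {α = α} {i} {replicate q a}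
        ((λ eq → αi≢a (trans eq (lookup-replicate i a))) ,
         λ {j} j≢i → trans (rest j≢i) (sym (lookup-replicate j a)))
    codeword (inj₁ (i , j , i≢j , αi≡αj , off))
      with a , missing ← missing-value α i
      with π , eq ← injective⇒permVertex {α [ i ]≔ a} (fill-injective {α = α} off missing)
      with alternating⊎transpose π i≢j
    ... | inj₁ even = α [ i ]≔ a , inj₁ (π , even , eq) ,
      ~⇒adjacent (~-update {α = α} {i} λ αi≡a → missing (i≢j ∘ sym) (trans (sym αi≡αj) αi≡a))
    -- Now the missing value `a` goes to `j` instead of `i`; the resulting vertex differs from `α`
    -- only at `j`.
    ... | inj₂ even = permVertex (transpose i j ∘ₚ π) , inj₁ (transpose i j ∘ₚ π , even , refl) ,
      ~⇒adjacent {α = α} {j} {permVertex (transpose i j ∘ₚ π)}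
      ((λ αj≡ → missing (i≢j ∘ sym) (trans αj≡ (trans (lookup-permVertex (transpose i j ∘ₚ π) j)
                  (trans (cong (π ⟨$⟩ʳ_) (transpose-matchʳ i j)) πi≡a)))) , agree)
      where
      π≡ : ∀ k → π ⟨$⟩ʳ k ≡ lookup (α [ i ]≔ a) k
      π≡ k = trans (sym (lookup-permVertex π k)) (cong (λ γ → lookup γ k) (sym eq))
      πi≡a : π ⟨$⟩ʳ i ≡ a
      πi≡a = trans (π≡ i) (lookup∘update i α a)
      agree : ∀ {k} → k ≢ j → lookup α k ≡ lookup (permVertex (transpose i j ∘ₚ π)) k
      agree {k} k≢j = trans (value (k ≟ i)) (sym (lookup-permVertex (transpose i j ∘ₚ π) k))
        where
        value : Dec (k ≡ i) → lookup α k ≡ π ⟨$⟩ʳ PC.transpose i j k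
        value (yes refl) = trans αi≡αj (trans (sym (lookup∘update′ (i≢j ∘ sym) α a))
          (trans (sym (π≡ j)) (cong (π ⟨$⟩ʳ_) (sym (transpose-matchˡ i j)))))
        value (no k≢i) = trans (sym (lookup∘update′ k≢i α a))
          (trans (sym (π≡ k)) (cong (π ⟨$⟩ʳ_) (sym (transpose-mismatch k≢i k≢j))))

  Diag⋊L-Γ₁ : 3 < q → g ∈ Diag⋊L → α ∈ Γ₁ (ExtendedCode q) → (α ^ g) ∈ Γ₁ (ExtendedCode q)
  Diag⋊L-Γ₁ {g} {α} 3<q g∈ = boundary⇒Γ₁ 3<q ∘ Diag⋊L-boundary {g} {α} g∈ ∘ Γ₁⇒boundary {α}

  Diag⋊L-fixes-Γ₁ : 3 < q → Fixes Diag⋊L (Γ₁ (ExtendedCode q))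
  Diag⋊L-fixes-Γ₁ 3<q {g} g∈ =
    (λ (α , α∈ , eq) → subst (Γ₁ (ExtendedCode q)) (sym eq) (Diag⋊L-Γ₁ {g} {α} 3<q g∈ α∈))
    , λ {β} β∈ → β ^ invert g
               , Diag⋊L-Γ₁ {invert g} {β} 3<q (IsSubgroup.⁻¹-closed Diag⋊L-subgroup {g} g∈) β∈
               , sym (invert-^ g β)

  -- The setwise stabiliser

  PreservesBoundary : Automorphism q q → Set
  PreservesBoundary g = ∀ {α} → Boundary α → Boundary (α ^ g)

  PreservesCore : Automorphism q q → Set
  PreservesCore g = ∀ {α} → Core α → Core (α ^ g)

  stabiliser⇒preserves : 3 < q → g ∈ Stabiliser (Γ₁ (ExtendedCode q)) →
                         PreservesBoundary g × PreservesBoundary (invert g)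
  stabiliser⇒preserves {g} 3<q (forth , back) =
    (λ {α} α∈ → Γ₁⇒boundary (forth (α , boundary⇒Γ₁ 3<q α∈ , refl))) ,
    λ {α} α∈ → let β , β∈ , α≡βg = back (boundary⇒Γ₁ 3<q α∈)
               in subst Boundary (trans (sym (^-invert g β)) (cong (_^ invert g) (sym α≡βg))) (Γ₁⇒boundary β∈)

  -- Every neighbour of `α ^ g` is the image of a neighbour of `α`, which lies in the boundary;
  -- `full⇒core` then applies to `α ^ g`.
  preservesBoundary⇒preservesCore : 4 < q → PreservesBoundary g → PreservesCore g
  preservesBoundary⇒preservesCore {g} 4<q preserves {α} α∈ = full⇒core 4<q λ {i} {β} αg~β →
    let j , α~βg⁻¹ = ^-~ (invert g) αg~β
    in subst Boundary (invert-^ g β) (preserves (core-neighbour α∈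
         (subst (λ γ → γ ~[ j ] (β ^ invert g)) (^-invert g α) α~βg⁻¹)))

  -- Off `i` and `j` two equal entries remain, which excludes a permutation vertex and determines
  -- the constant.
  core-near-constant : ∀ {i j a} → 3 < q → Core α → (∀ {k} → k ≢ i → k ≢ j → lookup α k ≡ a) → α ≡ replicate q a
  core-near-constant {α} {i} {j} {a} 3<q α∈ agree
    with k , l , k≢l , (k≢i , k≢j) , (l≢i , l≢j) ← two-others 3<q i j
    with α∈
  ... | inj₁ inj = contradiction (inj (trans (agree k≢i k≢j) (sym (agree l≢i l≢j)))) k≢l
  ... | inj₂ (b , const) = lookup-ext λ x →
    trans (const x) (trans (sym (const k)) (trans (agree k≢i k≢j) (sym (lookup-replicate x a))))

  swapped : Fin q → Fin q → Vertex q q → Vertex q q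
  swapped i j α = tabulate (λ k → lookup α (PC.transpose i j k))

  -- Distance 2 is expressed by an explicit path, because automorphisms are only known to preserve
  -- edges.
  swapped-path : ∀ {i j} → i ≢ j → lookup α i ≢ lookup α j →
                 let β = α [ i ]≔ lookup α j in α ~[ i ] β × β ~[ j ] swapped i j α
  swapped-path {α} {i} {j} i≢j αi≢αj =
    ~-update {α = α} αi≢αj , (λ eq → αi≢αj (sym (trans (sym (lookup∘update′ (i≢j ∘ sym) α _))
      (trans eq (trans (lookup∘tabulate _ j) (cong (lookup α) (transpose-matchʳ i j))))))) , agree
    where
    agree : ∀ {k} → k ≢ j → lookup (α [ i ]≔ lookup α j) k ≡ lookup (swapped i j α) k
    agree {k} k≢j = trans (value (k ≟ i)) (sym (lookup∘tabulate _ k))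
      where
      value : Dec (k ≡ i) → lookup (α [ i ]≔ lookup α j) k ≡ lookup α (PC.transpose i j k)
      value (yes refl) = trans (lookup∘update i α _) (cong (lookup α) (sym (transpose-matchˡ i j)))
      value (no k≢i)   = trans (lookup∘update′ k≢i α _) (cong (lookup α) (sym (transpose-mismatch k≢i k≢j)))

  swapped-injective : ∀ {i j} → Injective _≡_ _≡_ (lookup α) → Injective _≡_ _≡_ (lookup (swapped i j α))
  swapped-injective {α} {i} {j} inj {k} {l} eq = permutation-injective (transpose i j)
    (inj (trans (sym (lookup∘tabulate _ k)) (trans eq (lookup∘tabulate _ l))))

  -- A permutation vertex has core vertices at distance 2, a constant one does not.
  constant-image-¬injective : ∀ {i j a} → 3 < q → PreservesCore (invert g) → i ≢ j →
                              ¬ Injective _≡_ _≡_ (lookup (replicate q a ^ g))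
  constant-image-¬injective {g} {i} {j} {a} 3<q preserves⁻¹ i≢j inj
    with α~μ , μ~ν ← swapped-path {replicate q a ^ g} {i} {j} i≢j (i≢j ∘ inj)
    with i′ , αg⁻¹~μg⁻¹ ← ^-~ (invert g) α~μ
    with j′ , μg⁻¹~νg⁻¹ ← ^-~ (invert g) μ~ν
    -- Since `ν` pulls back to `replicate q a`, it equals the image of that vertex, although its
    -- entry at `i` is the entry of the image at `j`.
    = i≢j (sym (inj (begin
        lookup (replicate q a ^ g) j                     ≡⟨ cong (lookup (replicate q a ^ g)) (transpose-matchˡ i j) ⟨
        lookup (replicate q a ^ g) (PC.transpose i j i)  ≡⟨ lookup∘tabulate _ i ⟨
        lookup ν i                                       ≡⟨ cong (λ γ → lookup γ i) (invert-^ g ν) ⟨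
        lookup ((ν ^ invert g) ^ g) i                    ≡⟨ cong (λ γ → lookup (γ ^ g) i) νg⁻¹-constant ⟩
        lookup (replicate q a ^ g) i                     ∎)))
    where
    open ≡-Reasoning
    open _~[_]_
    ν : Vertex q q
    ν = swapped i j (replicate q a ^ g)
    νg⁻¹-constant : ν ^ invert g ≡ replicate q a
    νg⁻¹-constant = core-near-constant {i = i′} {j′} 3<q
      (preserves⁻¹ {ν} (inj₁ (swapped-injective {replicate q a ^ g} {i} {j} inj))) λ {k} k≢i′ k≢j′ →
        trans (sym (trans (agree αg⁻¹~μg⁻¹ k≢i′) (agree μg⁻¹~νg⁻¹ k≢j′)))
              (trans (cong (λ γ → lookup γ k) (^-invert g (replicate q a))) (lookup-replicate k a))

  constant-image : 3 < q → PreservesCore g → PreservesCore (invert g) → ∀ a → Constant (replicate q a ^ g)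
  constant-image {g} 3<q preserves preserves⁻¹ a
    with preserves {replicate q a} (inj₂ (a , λ k → lookup-replicate k a))
  ... | inj₂ const = const
  ... | inj₁ inj
    with i , _ ← fresh [] (≤-trans (s≤s z≤n) 3<q)
    with j , j∉ ← fresh (i ∷ []) (≤-trans (m≤m+n 2 2) 3<q)
    = ⊥-elim (constant-image-¬injective {g} {i} {j} 3<q preserves⁻¹ (j∉ ∘ here ∘ sym) inj)

  constant-images-injective : (constants : ∀ a → Constant (replicate q a ^ g)) → Injective _≡_ _≡_ (proj₁ ∘ constants)
  constant-images-injective {g} constants {a} {b} eq = begin
    a                          ≡⟨ lookup-replicate a a ⟨
    lookup (replicate q a) a   ≡⟨ cong (λ γ → lookup γ a) (^-injective g (lookup-ext images-agree)) ⟩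
    lookup (replicate q b) a   ≡⟨ lookup-replicate a b ⟩
    b                          ∎
    where
    open ≡-Reasoning
    images-agree : ∀ k → lookup (replicate q a ^ g) k ≡ lookup (replicate q b ^ g) k
    images-agree k = trans (proj₂ (constants a) k) (trans eq (sym (proj₂ (constants b) k)))

  -- The entry of `α ^ g` at `σ k` depends only on the entry of `α` at `k`, so `α` may be replaced
  -- by a constant vertex. The action of `g` on constants gives one `y` for all coordinates.
  constant-images⇒Diag⋊L : 1 < q → (∀ a → Constant (replicate q a ^ g)) → g ∈ Diag⋊L
  constant-images⇒Diag⋊L {g} 1<q constants =
    let ω , _ = fresh [] (≤-trans (s≤s z≤n) 1<q)
        σ , coordinate = image-coordinates g 1<q (replicate q ω)
        y , y≗ = injective⇒permutation {f = proj₁ ∘ constants} (constant-images-injective {g} constants)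
    in acts⇒Diag⋊L {y} {σ} {g} λ α k → begin
         lookup (α ^ g) (σ ⟨$⟩ʳ k)                           ≡⟨ coordinate {α} {replicate q (lookup α k)}
                                                                  (sym (lookup-replicate k (lookup α k))) ⟩
         lookup (replicate q (lookup α k) ^ g) (σ ⟨$⟩ʳ k)    ≡⟨ proj₂ (constants (lookup α k)) (σ ⟨$⟩ʳ k) ⟩
         proj₁ (constants (lookup α k))                      ≡⟨ y≗ (lookup α k) ⟨
         y ⟨$⟩ʳ lookup α k                                   ∎
    where open ≡-Reasoning

  stabiliser⇒Diag⋊L : 4 < q → g ∈ Stabiliser (Γ₁ (ExtendedCode q)) → g ∈ Diag⋊L
  stabiliser⇒Diag⋊L {g} 4<q stab =
    constant-images⇒Diag⋊L {g} (≤-trans (m≤m+n 2 3) 4<q) (constant-image {g} 3<q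
      (preservesBoundary⇒preservesCore {g} 4<q preserves)
      (preservesBoundary⇒preservesCore {invert g} 4<q preserves⁻¹))
    where
    3<q : 3 < q
    3<q = ≤-trans (m≤m+n 4 1) 4<q
    preserves : PreservesBoundary g
    preserves {α} = proj₁ (stabiliser⇒preserves {g} 3<q stab) {α}
    preserves⁻¹ : PreservesBoundary (invert g)
    preserves⁻¹ {α} = proj₂ (stabiliser⇒preserves {g} 3<q stab) {α}

  -- Minimum distance

  dist-self : ∀ {n} (α : Vertex n q) → dist α α ≡ 0
  dist-self []      = refl
  dist-self (a ∷ α) rewrite dec-true (a ≟ a) refl = dist-self α

  dist-update : ∀ {n} (α β : Vertex n q) i → lookup α i ≢ lookup β i →
                dist α β ≡ suc (dist α (β [ i ]≔ lookup α i))
  dist-update (a ∷ α) (b ∷ β) zero    a≢b rewrite dec-false (a ≟ b) a≢b | dec-true (a ≟ a) refl = refl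
  dist-update (a ∷ α) (b ∷ β) (suc i) neq with does (a ≟ b)
  ... | true  = dist-update α β i neq
  ... | false = cong suc (dist-update α β i neq)

  -- Correcting `β` at the three positions in turn lowers the distance by 1 each time.
  dist-≥3 : ∀ (α β : Vertex q q) {i j k} → i ≢ j → i ≢ k → j ≢ k →
            lookup α i ≢ lookup β i → lookup α j ≢ lookup β j → lookup α k ≢ lookup β k → 3 ≤ dist α β
  dist-≥3 α β {i} {j} {k} i≢j i≢k j≢k αi≢βi αj≢βj αk≢βk = ≤-trans (m≤m+n 3 _) (≤-reflexive (sym (begin
    dist α β              ≡⟨ dist-update α β i αi≢βi ⟩
    suc (dist α β₁)       ≡⟨ cong suc (dist-update α β₁ j (αj≢βj ∘ λ eq → trans eq (lookup∘update′ (i≢j ∘ sym) β _))) ⟩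
    suc (suc (dist α β₂)) ≡⟨ cong (λ d → suc (suc d)) (dist-update α β₂ k (αk≢βk ∘ λ eq →
                               trans eq (trans (lookup∘update′ (j≢k ∘ sym) β₁ _) (lookup∘update′ (i≢k ∘ sym) β _)))) ⟩
    suc (suc (suc (dist α (β₂ [ k ]≔ lookup α k)))) ∎)))
    where
    open ≡-Reasoning
    β₁ = β [ i ]≔ lookup α i
    β₂ = β₁ [ j ]≔ lookup α j

  -- Serves all pairs involving a constant vertex: a permutation vertex agrees with it at one
  -- position only, and at least three others remain.
  dist-constant : 3 < q → ∀ (α β : Vertex q q) {p} → (∀ {k} → k ≢ p → lookup α k ≢ lookup β k) → 3 ≤ dist α β
  dist-constant 3<q α β {p} differ
    with i , j , i≢j , (i≢p , _) , (j≢p , _) ← two-others 3<q p p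
    with k , k∉ ← fresh (i ∷ j ∷ p ∷ []) 3<q
    = dist-≥3 α β i≢j (k∉ ∘ here ∘ sym) (k∉ ∘ there ∘ here ∘ sym)
        (differ i≢p) (differ j≢p) (differ (k∉ ∘ there ∘ there ∘ here))

  -- Two permutations at distance 2 differ by a transposition.
  dist-alternating : ∀ {π ρ : Permutation′ q} → Alternating π → Alternating ρ →
                     permVertex π ≢ permVertex ρ → 3 ≤ dist (permVertex π) (permVertex ρ)
  dist-alternating {π} {ρ} π-even ρ-even π≢ρ
    with i , πi≢ρi ← ¬∀⟶∃¬ q _ (λ k → (π ⟨$⟩ʳ k) ≟ (ρ ⟨$⟩ʳ k)) (π≢ρ ∘ tabulate-cong)
    = third (k ≟ i) (any? λ l → ¬? (l ≟ i) ×-dec (¬? (l ≟ j) ×-dec ¬? ((π ⟨$⟩ʳ l) ≟ (ρ ⟨$⟩ʳ l))))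
    where
    -- At `j` the permutation `π` takes the value of `ρ` at `i`, and at `k` that of `ρ` at `j`. They
    -- differ at `i`, `j` and, unless `k` is `i`, also at `k`; if `k` is `i`, parity forces a third
    -- position elsewhere.
    j k : Fin q
    j = π ⟨$⟩ˡ (ρ ⟨$⟩ʳ i)
    k = π ⟨$⟩ˡ (ρ ⟨$⟩ʳ j)
    πj≡ρi : π ⟨$⟩ʳ j ≡ ρ ⟨$⟩ʳ i
    πj≡ρi = inverseʳ π
    πk≡ρj : π ⟨$⟩ʳ k ≡ ρ ⟨$⟩ʳ j
    πk≡ρj = inverseʳ π
    i≢j : i ≢ j
    i≢j i≡j = πi≢ρi (trans (cong (π ⟨$⟩ʳ_) i≡j) πj≡ρi)
    πj≢ρj : π ⟨$⟩ʳ j ≢ ρ ⟨$⟩ʳ j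
    πj≢ρj eq = i≢j (permutation-injective ρ (trans (sym πj≡ρi) eq))
    j≢k : j ≢ k
    j≢k j≡k = πj≢ρj (trans (cong (π ⟨$⟩ʳ_) j≡k) πk≡ρj)

    differ : ∀ {l} → π ⟨$⟩ʳ l ≢ ρ ⟨$⟩ʳ l → lookup (permVertex π) l ≢ lookup (permVertex ρ) l
    differ {l} πl≢ρl eq = πl≢ρl (trans (sym (lookup-permVertex π l)) (trans eq (lookup-permVertex ρ l)))

    third : Dec (k ≡ i) → Dec (∃ λ l → l ≢ i × l ≢ j × π ⟨$⟩ʳ l ≢ ρ ⟨$⟩ʳ l) →
            3 ≤ dist (permVertex π) (permVertex ρ)
    third (no k≢i) _ = dist-≥3 (permVertex π) (permVertex ρ) i≢j (k≢i ∘ sym) j≢k (differ πi≢ρi) (differ πj≢ρj)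
      (differ λ eq → j≢k (permutation-injective ρ (trans (sym πk≡ρj) eq)))
    third (yes _) (yes (l , l≢i , l≢j , πl≢ρl)) = dist-≥3 (permVertex π) (permVertex ρ)
      i≢j (l≢i ∘ sym) (l≢j ∘ sym) (differ πi≢ρi) (differ πj≢ρj) (differ πl≢ρl)
    third (yes k≡i) (no ¬l) = contradiction (λ x → transposed x (x ≟ i) (x ≟ j))
      (alternating-≉-transpose {π = π} {ρ} π-even ρ-even i≢j)
      where
      transposed : ∀ x → Dec (x ≡ i) → Dec (x ≡ j) → π ⟨$⟩ʳ x ≡ ρ ⟨$⟩ʳ PC.transpose i j x
      transposed x (yes refl) _ =
        trans (cong (π ⟨$⟩ʳ_) (sym k≡i)) (trans πk≡ρj (cong (ρ ⟨$⟩ʳ_) (sym (transpose-matchˡ i j))))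
      transposed x (no _) (yes refl) = trans πj≡ρi (cong (ρ ⟨$⟩ʳ_) (sym (transpose-matchʳ i j)))
      transposed x (no x≢i) (no x≢j) = trans
        (decidable-stable ((π ⟨$⟩ʳ x) ≟ (ρ ⟨$⟩ʳ x)) λ neq → ¬l (x , x≢i , x≢j , neq))
        (cong (ρ ⟨$⟩ʳ_) (sym (transpose-mismatch x≢i x≢j)))

  minimum-distance-≥3 : 3 < q → α ∈ ExtendedCode q → β ∈ ExtendedCode q → α ≢ β → 3 ≤ dist α β
  minimum-distance-≥3 3<q (inj₁ (π , π-even , refl)) (inj₁ (ρ , ρ-even , refl)) α≢β =
    dist-alternating {π} {ρ} π-even ρ-even α≢β
  minimum-distance-≥3 3<q (inj₁ (π , _ , refl)) (inj₂ (a , refl)) _ =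
    dist-constant 3<q (permVertex π) (replicate q a) {π ⟨$⟩ˡ a} λ {k} k≢ eq → k≢ (trans (sym (inverseˡ π))
      (cong (π ⟨$⟩ˡ_) (trans (sym (lookup-permVertex π k)) (trans eq (lookup-replicate k a)))))
  minimum-distance-≥3 3<q (inj₂ (a , refl)) (inj₁ (π , _ , refl)) _ =
    dist-constant 3<q (replicate q a) (permVertex π) {π ⟨$⟩ˡ a} λ {k} k≢ eq → k≢ (trans (sym (inverseˡ π))
      (cong (π ⟨$⟩ˡ_) (trans (sym (lookup-permVertex π k)) (trans (sym eq) (lookup-replicate k a)))))
  minimum-distance-≥3 3<q (inj₂ (a , refl)) (inj₂ (b , refl)) α≢β =
    -- Distinct constants differ everywhere, so the excluded position `a` is arbitrary.
    dist-constant 3<q (replicate q a) (replicate q b) {a} λ {k} _ eq →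
      α≢β (cong (replicate q) (trans (sym (lookup-replicate k a)) (trans eq (lookup-replicate k b))))

minimum-distance : ∀ n → IsMinimumDistance (ExtendedCode (suc (suc (suc (suc n))))) 3
minimum-distance n = record
  -- A 3-cycle, even as a product of two transpositions, differs from the identity at exactly three
  -- positions.
  { attained = permVertex (eval cycle) , permVertex Perm.id
             , inj₁ (eval cycle , (cycle , (λ ()) ∷ (λ ()) ∷ [] , ∣-refl , λ _ → refl) , refl)
             , inj₁ (Perm.id , ([] , [] , 2 ∣0 , λ _ → refl) , refl)
             , (λ ())
             , cong (λ d → suc (suc (suc d))) (dist-self {n = n} (tabulate (λ i → suc (suc (suc (suc i))))))
  ; minimal = minimum-distance-≥3 (m≤m+n 4 n)
  }
  where
  cycle : TranspositionList (suc (suc (suc (suc n))))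
  cycle = (0F , 1F) ∷ (1F , 2F) ∷ []

-- The code is moved, and the action on its neighbours is intransitive

¬fixes-code : ∀ n → ¬ Fixes Diag⋊L (ExtendedCode (suc (suc n)))
¬fixes-code n fixes = not-in-code (proj₁ (fixes {g} g∈Diag⋊L)
    (permVertex Perm.id , inj₁ (Perm.id , ([] , [] , 2 ∣0 , λ _ → refl) , refl) , refl))
  where
  swap : Permutation′ (suc (suc n))
  swap = transpose 0F 1F
  g : Automorphism (suc (suc n)) (suc (suc n))
  g = fromN λ _ → swap
  g∈Diag⋊L : g ∈ Diag⋊L
  g∈Diag⋊L = acts⇒Diag⋊L {y = swap} {Perm.id} {g} λ α k → lookup∘tabulate (λ i → swap ⟨$⟩ʳ lookup α i) k
  -- The image of the identity vertex is the vertex of `swap`, which is odd and not constant.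
  not-in-code : (permVertex Perm.id ^ g) ∉ ExtendedCode (suc (suc n))
  not-in-code (inj₁ (π , π-even , eq)) =
    alternating-≉-transpose {π = π} {Perm.id} {0F} {1F} π-even ([] , [] , 2 ∣0 , λ _ → refl) (λ ()) λ k → begin
      π ⟨$⟩ʳ k                              ≡⟨ lookup-permVertex π k ⟨
      lookup (permVertex π) k               ≡⟨ cong (λ γ → lookup γ k) eq ⟨
      lookup (permVertex Perm.id ^ g) k     ≡⟨ lookup∘tabulate (λ i → swap ⟨$⟩ʳ lookup (permVertex Perm.id) i) k ⟩
      swap ⟨$⟩ʳ lookup (permVertex Perm.id) k  ≡⟨ cong (swap ⟨$⟩ʳ_) (lookup-permVertex Perm.id k) ⟩
      swap ⟨$⟩ʳ k                           ∎
    where open ≡-Reasoning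
  not-in-code (inj₂ (a , ()))

-- The group keeps near-constant vertices near-constant, so it cannot carry `(1,0,0,0,...)` to the
-- paired vertex `(1,1,2,3,...)`.
¬transitive : ∀ n → ¬ TransitiveOn Diag⋊L (Γ₁ (ExtendedCode (suc (suc (suc (suc n))))))
¬transitive n transitive =
  let g , g∈ , αg≡β = transitive (boundary⇒Γ₁ {α = α} 3<q (inj₂ α-nearConstant)) (boundary⇒Γ₁ {α = β} 3<q (inj₁ β-paired))
      y , σ , acts = Diag⋊L⇒acts {g = g} g∈
  in paired⇒¬nearConstant {α = β} 3<q β-paired
       (subst NearConstant αg≡β (acts-nearConstant {y = y} {σ} {g} {α} acts α-nearConstant))
  where
  q : ℕ
  q = suc (suc (suc (suc n)))
  3<q : 3 < q
  3<q = m≤m+n 4 n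
  α β : Vertex q q
  α = replicate q 0F [ 0F ]≔ 1F
  β = tabulate id [ 0F ]≔ 1F
  α-nearConstant : NearConstant α
  α-nearConstant = 0F , 0F , (λ ()) , λ {k} k≢0 →
    trans (lookup∘update′ k≢0 (replicate q 0F) 1F) (lookup-replicate k 0F)
  β-paired : Paired β
  β-paired = 0F , 1F , (λ ()) , refl , λ {k} {l} k≢0 l≢0 eq →
    trans (sym (value k≢0)) (trans eq (value l≢0))
    where
    value : ∀ {k} → k ≢ 0F → lookup β k ≡ k
    value {k} k≢0 = trans (lookup∘update′ k≢0 (tabulate id) 1F) (lookup∘tabulate id k)

proposition3p10 : ∀ (q : ℕ) → 4 ≤ q →
    let C : Code q q
        C = permCode Alternating ∪ Rep q q
        X : Pred (Automorphism q q) 0ℓ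
        X = Diag⋊L
    in IsElusivePair C X
       × ¬ TransitiveOn X (Γ₁ C)
       × (5 ≤ q → X ≐ Stabiliser (Γ₁ C))
proposition3p10 q@(suc (suc (suc (suc n)))) 4≤q@(s≤s (s≤s (s≤s (s≤s z≤n)))) =
  (3 , record
    { minimumDistance = minimum-distance n
    ; subgroup        = Diag⋊L-subgroup
    ; fixes-Γ₁        = λ {g} → Diag⋊L-fixes-Γ₁ 4≤q {g}
    ; ¬fixes-C        = ¬fixes-code (suc (suc n))
    })
  , ¬transitive n
  , λ 5≤q → (λ {g} → Diag⋊L-fixes-Γ₁ 4≤q {g}) , λ {g} → stabiliser⇒Diag⋊L {g = g} 5≤q
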